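{- Let $m\ge 3$ and $n\ge 1$ be integers, let $P_m$ be the path with $m$ vertices, and let $\mathbf{G}:=P_m^n$ be the $n$-dimensional $m\times\cdots\times m$ grid. Let $\emptyset\neq A\subseteq V(\mathbf{G})$. If $|A|\le(m/e)^n$, then $$e_{\mathbf{G}}(A,A^c)\ge n\cdot|A|^{1-1/n},$$ and if $(m/e)^n\le|A|\le m^n/2$, then $$e_{\mathbf{G}}(A,A^c)\ge\frac{|A|}{m}\cdot e\log\frac{m^n}{|A|}.$$ Here $e$ without a subscript is Euler's number.
   Context: $\log$ is the natural logarithm. For a graph $G$ and $A\subseteq V(G)$, $A^c=V(G)\setminus A$ and $e_G(A,A^c)$ is the number of edges of $G$ with exactly one endpoint in $A$. $G^n$ denotes the product graph $G\square\cdots\square G$ ($n$ copies): its vertex set is $V(G)^n$ and its edges are all pairs $\{u,v\}$ for which there is an index $j\in\{1,\dots,n\}$ such that $u_jv_j\in E(G)$ and $u_l=v_l$ for all $l\neq j$. -}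

module Defs where

open import Data.Bool using (Bool; true; false; T; not; _∧_; if_then_else_)
open import Data.Fin using (Fin; toℕ)
import Data.Fin.Properties as Fin
open import Data.Integer using (+_; -[1+_]; +≤+; -≤+)
import Data.Integer as ℤ
import Data.Integer.Properties as ℤ
open import Data.List using (List; []; _∷_; length; filterᵇ; allFin; cartesianProduct; cartesianProductWith)
open import Data.List.Membership.Propositional using (_∈_)
open import Data.List.Membership.Propositional.Properties using (∈-allFin; ∈-cartesianProductWith⁺)
open import Data.List.Relation.Unary.All using ([])
open import Data.List.Relation.Unary.AllPairs using ([]; _∷_)
open import Data.List.Relation.Unary.Any using (here)
open import Data.List.Relation.Unary.Unique.Propositional using (Unique)
import Data.List.Relation.Unary.Unique.Propositional.Properties as Unique
open import Data.Nat as ℕ using (ℕ; zero; suc; _!)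
import Data.Nat.Properties as ℕ
open import Data.Product using (Σ; ∃; ∃-syntax; _×_; _,_; proj₁; proj₂)
open import Data.Rational using (ℚ; mkℚ; 0ℚ; 1ℚ; ½; _+_; _*_; _-_; -_; ∣_∣; _/_; 1/_; _≤_; _<_; *≤*; *<*; toℚᵘ; fromℚᵘ)
import Data.Rational as ℚ
open import Data.Rational.Properties using (_≟_; _≤?_; _<?_)
import Data.Rational.Properties as ℚ
open import Data.Rational.Solver using (module +-*-Solver)
import Data.Rational.Unnormalised as ℚᵘ
import Data.Rational.Unnormalised.Properties as ℚᵘ
open import Data.Sum using (_⊎_; inj₁; inj₂)
open import Data.Vec using (Vec; []; _∷_; lookup)
import Data.Vec.Properties as Vec
open import Function using (_∘_)
open import Relation.Binary.Definitions using (Decidable; DecidableEquality)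
open import Relation.Binary.PropositionalEquality using (_≡_; _≢_; refl; sym; trans; cong; cong₂; subst; subst₂)
open import Relation.Nullary using (¬_; yes; no; Dec; contradiction)
open import Relation.Nullary.Decidable using (⌊_⌋; _×-dec_; _⊎-dec_; _→-dec_; ¬?)
open import Algebra.Definitions.RawSemiring ℚ.+-*-rawSemiring using (_^_)

open +-*-Solver using (solve; _:+_; _:*_; _:-_; _:=_; :-_; con)

fromℕ : ℕ → ℚ
fromℕ n = + n / 1

-- Total reciprocal, with recip 0 = 0.
recip : ℚ → ℚ
recip q with q ≟ 0ℚ
... | yes _  = 0ℚ
... | no q≢0 = (1/ q) {{ℚ.≢-nonZero q≢0}}

infixl 7 _/₀_

-- Quotient of natural numbers, with a /₀ 0 = 0.
_/₀_ : ℕ → ℕ → ℚ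
a /₀ b = fromℕ a * recip (fromℕ b)

fromℕ-suc : ∀ n → fromℕ (suc n) ≡ 1ℚ + fromℕ n
fromℕ-suc n = ℚ.toℚᵘ-injective (ℚᵘ.≃-trans (ℚ.toℚᵘ-fromℚᵘ (ℚᵘ.mkℚᵘ (+ suc n) 0))
  (ℚᵘ.≃-sym (ℚᵘ.≃-trans (ℚ.toℚᵘ-homo-+ 1ℚ (fromℕ n))
  (ℚᵘ.≃-trans (ℚᵘ.+-cong {ℚᵘ.1ℚᵘ} ℚᵘ.≃-refl (ℚ.toℚᵘ-fromℚᵘ (ℚᵘ.mkℚᵘ (+ n) 0)))
    (ℚᵘ.*≡* (cong (λ k → (+ 1 ℤ.+ k) ℤ.* + 1) (ℤ.*-identityʳ (+ n))))))))

fromℕ-* : ∀ a b → fromℕ (a ℕ.* b) ≡ fromℕ a * fromℕ b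
fromℕ-* zero    b = sym (ℚ.*-zeroˡ (fromℕ b))
fromℕ-* (suc a) b = trans (fromℕ-+ b (a ℕ.* b)) (trans (cong (λ h → fromℕ b + h) (fromℕ-* a b))
    (trans (solve 2 (λ x y → y :+ x :* y := (con 1ℚ :+ x) :* y) refl (fromℕ a) (fromℕ b))
           (cong (_* fromℕ b) (sym (fromℕ-suc a)))))
  where
  fromℕ-+ : ∀ a b → fromℕ (a ℕ.+ b) ≡ fromℕ a + fromℕ b
  fromℕ-+ zero    b = sym (ℚ.+-identityˡ (fromℕ b))
  fromℕ-+ (suc a) b = trans (fromℕ-suc (a ℕ.+ b)) (trans (cong (λ h → 1ℚ + h) (fromℕ-+ a b))
    (trans (sym (ℚ.+-assoc 1ℚ (fromℕ a) (fromℕ b))) (cong (_+ fromℕ b) (sym (fromℕ-suc a)))))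

≤-from-gap : ∀ {p q} d → 0ℚ ≤ d → q ≡ p + d → p ≤ q
≤-from-gap {p} d 0≤d refl = subst (_≤ p + d) (ℚ.+-identityʳ p) (ℚ.+-monoʳ-≤ p 0≤d)

gap : ∀ {p q} → p ≤ q → 0ℚ ≤ q - p
gap {p} {q} p≤q = subst (_≤ q - p) (ℚ.+-inverseʳ p) (ℚ.+-monoˡ-≤ (- p) p≤q)

0≤1 : 0ℚ ≤ 1ℚ
0≤1 = *≤* (+≤+ ℕ.z≤n)

0<1 : 0ℚ < 1ℚ
0<1 = ℚ.positive⁻¹ 1ℚ

0≤½ : 0ℚ ≤ ½
0≤½ = ℚ.nonNegative⁻¹ ½

0≤+ : ∀ {p q} → 0ℚ ≤ p → 0ℚ ≤ q → 0ℚ ≤ p + q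
0≤+ 0≤p 0≤q = ℚ.+-mono-≤ 0≤p 0≤q

*-monoʳ : ∀ {p q} r → 0ℚ ≤ r → p ≤ q → r * p ≤ r * q
*-monoʳ r 0≤r = ℚ.*-monoˡ-≤-nonNeg r {{ℚ.nonNegative 0≤r}}

*-monoˡ : ∀ {p q} r → 0ℚ ≤ r → p ≤ q → p * r ≤ q * r
*-monoˡ r 0≤r = ℚ.*-monoʳ-≤-nonNeg r {{ℚ.nonNegative 0≤r}}

0≤* : ∀ {p q} → 0ℚ ≤ p → 0ℚ ≤ q → 0ℚ ≤ p * q
0≤* {p} {q} 0≤p 0≤q = subst (_≤ p * q) (ℚ.*-zeroʳ p) (*-monoʳ p 0≤p 0≤q)

0<* : ∀ {p q} → 0ℚ < p → 0ℚ < q → 0ℚ < p * q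
0<* {p} {q} 0<p 0<q = subst (_< p * q) (ℚ.*-zeroʳ p) (ℚ.*-monoʳ-<-pos p {{ℚ.positive 0<p}} 0<q)

*-mono : ∀ {p q r s} → 0ℚ ≤ p → p ≤ q → 0ℚ ≤ r → r ≤ s → p * r ≤ q * s
*-mono {p} {q} {r} {s} 0≤p p≤q 0≤r r≤s =
  ℚ.≤-trans (*-monoˡ r 0≤r p≤q) (*-monoʳ q (ℚ.≤-trans 0≤p p≤q) r≤s)

0≤fromℕ : ∀ n → 0ℚ ≤ fromℕ n
0≤fromℕ zero    = ℚ.≤-refl
0≤fromℕ (suc n) = subst (0ℚ ≤_) (sym (fromℕ-suc n)) (0≤+ 0≤1 (0≤fromℕ n))

fromℕ-mono : ∀ {m n} → m ℕ.≤ n → fromℕ m ≤ fromℕ n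
fromℕ-mono {n = n} ℕ.z≤n = 0≤fromℕ n
fromℕ-mono (ℕ.s≤s {m} {n} m≤n) =
  subst₂ _≤_ (sym (fromℕ-suc m)) (sym (fromℕ-suc n)) (ℚ.+-monoʳ-≤ 1ℚ (fromℕ-mono m≤n))

0<fromℕ-suc : ∀ n → 0ℚ < fromℕ (suc n)
0<fromℕ-suc n = subst (0ℚ <_) (sym (fromℕ-suc n)) (ℚ.+-mono-<-≤ 0<1 (0≤fromℕ n))

*-recip : ∀ {q} → 0ℚ < q → q * recip q ≡ 1ℚ
*-recip {q} 0<q with q ≟ 0ℚ
... | yes refl = contradiction refl (ℚ.<⇒≢ 0<q)
... | no q≢0   = ℚ.*-inverseʳ q {{ℚ.≢-nonZero q≢0}}

0<recip : ∀ {q} → 0ℚ < q → 0ℚ < recip q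
0<recip {q} 0<q with q ≟ 0ℚ
... | yes refl = contradiction refl (ℚ.<⇒≢ 0<q)
... | no q≢0   = ℚ.positive⁻¹ _ {{ℚ.1/pos⇒pos q {{ℚ.positive 0<q}}}}

archimedean : ∀ q → ∃[ n ] q ≤ fromℕ n
archimedean (mkℚ (+ n) d c) = n , ℚ.toℚᵘ-cancel-≤
  (ℚᵘ.≤-trans (ℚᵘ.*≤* {q = ℚᵘ.mkℚᵘ (+ n) 0} (ℤ.*-monoˡ-≤-nonNeg (+ n) (+≤+ (ℕ.s≤s ℕ.z≤n))))
              (ℚᵘ.≤-reflexive (ℚᵘ.≃-sym (ℚ.toℚᵘ-fromℚᵘ (ℚᵘ.mkℚᵘ (+ n) 0)))))
archimedean (mkℚ -[1+ n ] d c) = 0 , *≤* -≤+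

archimedean* : ∀ q {ε} → 0ℚ < ε → ∃[ n ] q ≤ fromℕ (suc n) * ε
archimedean* q {ε} 0<ε with archimedean (q * recip ε)
... | n , h = n , subst (_≤ fromℕ (suc n) * ε) eq
      (*-monoˡ ε (ℚ.<⇒≤ 0<ε) (ℚ.≤-trans h (fromℕ-mono (ℕ.n≤1+n n))))
  where
  eq : q * recip ε * ε ≡ q
  eq = trans (solve 3 (λ q r e → q :* r :* e := q :* (e :* r)) refl q (recip ε) ε)
      (trans (cong (q *_) (*-recip 0<ε)) (ℚ.*-identityʳ q))

shrink : ∀ C {ε} → 0ℚ ≤ C → 0ℚ < ε → ∃[ δ ] (0ℚ < δ × C * δ ≤ ε)
shrink C {ε} 0≤C 0<ε = ε * recip (1ℚ + C) , 0<* 0<ε 0<r , ≤-from-gap _ (ℚ.<⇒≤ (0<* 0<ε 0<r)) eq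
  where
  D>0 : 0ℚ < 1ℚ + C
  D>0 = ℚ.+-mono-<-≤ 0<1 0≤C
  r : ℚ
  r = recip (1ℚ + C)
  0<r : 0ℚ < r
  0<r = 0<recip D>0
  eq : ε ≡ C * (ε * r) + ε * r
  eq = trans (sym (ℚ.*-identityʳ ε)) (trans (cong (ε *_) (sym (*-recip D>0)))
    (solve 3 (λ c e r → e :* ((con 1ℚ :+ c) :* r) := c :* (e :* r) :+ e :* r) refl C ε r))

halve : ∀ {ε} → 0ℚ < ε → 0ℚ < ½ * ε
halve = 0<* (ℚ.positive⁻¹ ½)

halves : ∀ ε → ½ * ε + ½ * ε ≡ ε
halves = solve 1 (λ e → con ½ :* e :+ con ½ :* e := e) refl

∣∣-≤ : ∀ {p r} → p ≤ r → - p ≤ r → ∣ p ∣ ≤ r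
∣∣-≤ {p} p≤r -p≤r with ℚ.∣p∣≡p∨∣p∣≡-p p
... | inj₁ eq = subst (_≤ _) (sym eq) p≤r
... | inj₂ eq = subst (_≤ _) (sym eq) -p≤r

p≤∣p∣ : ∀ p → p ≤ ∣ p ∣
p≤∣p∣ p with ℚ.≤-total 0ℚ p
... | inj₁ 0≤p = ℚ.≤-reflexive (sym (ℚ.0≤p⇒∣p∣≡p 0≤p))
... | inj₂ p≤0 = ℚ.≤-trans p≤0 (ℚ.0≤∣p∣ p)

∣-∣-sym : ∀ p q → ∣ p - q ∣ ≡ ∣ q - p ∣
∣-∣-sym p q = trans (cong ∣_∣ (solve 2 (λ p q → p :- q := :- (q :- p)) refl p q)) (ℚ.∣-p∣≡∣p∣ (q - p))

∣-∣-via : ∀ p r q {a b} → ∣ p - r ∣ ≤ a → ∣ r - q ∣ ≤ b → ∣ p - q ∣ ≤ a + b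
∣-∣-via p r q h k = ℚ.≤-trans
  (ℚ.≤-reflexive (cong ∣_∣ (solve 3 (λ p q r → p :- q := (p :- r) :+ (r :- q)) refl p q r)))
  (ℚ.≤-trans (ℚ.∣p+q∣≤∣p∣+∣q∣ (p - r) (r - q)) (ℚ.+-mono-≤ h k))

*-dist : ∀ p p′ q q′ {b c β γ ε} → ∣ p ∣ ≤ b → ∣ q′ ∣ ≤ c → ∣ p - p′ ∣ ≤ γ → ∣ q - q′ ∣ ≤ β →
         b * β ≤ ½ * ε → c * γ ≤ ½ * ε → ∣ p * q - p′ * q′ ∣ ≤ ε
*-dist p p′ q q′ {b} {c} {β} {γ} {ε} hp hq hpp hqq bβ≤ cγ≤ =
  subst (∣ p * q - p′ * q′ ∣ ≤_) (halves ε) (∣-∣-via (p * q) (p * q′) (p′ * q′) left right)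
  where
  eq₁ : ∀ p q q′ → p * q - p * q′ ≡ p * (q - q′)
  eq₁ = solve 3 (λ p q q′ → p :* q :- p :* q′ := p :* (q :- q′)) refl
  eq₂ : ∀ p p′ q′ → p * q′ - p′ * q′ ≡ q′ * (p - p′)
  eq₂ = solve 3 (λ p p′ q′ → p :* q′ :- p′ :* q′ := q′ :* (p :- p′)) refl
  left : ∣ p * q - p * q′ ∣ ≤ ½ * ε
  left = ℚ.≤-trans (ℚ.≤-reflexive (trans (cong ∣_∣ (eq₁ p q q′)) (ℚ.∣p*q∣≡∣p∣*∣q∣ p (q - q′))))
    (ℚ.≤-trans (*-mono (ℚ.0≤∣p∣ p) hp (ℚ.0≤∣p∣ (q - q′)) hqq) bβ≤)
  right : ∣ p * q′ - p′ * q′ ∣ ≤ ½ * ε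
  right = ℚ.≤-trans (ℚ.≤-reflexive (trans (cong ∣_∣ (eq₂ p p′ q′)) (ℚ.∣p*q∣≡∣p∣*∣q∣ q′ (p - p′))))
    (ℚ.≤-trans (*-mono (ℚ.0≤∣p∣ q′) hq (ℚ.0≤∣p∣ (p - p′)) hpp) cγ≤)

recip-diff : ∀ {p q} → 0ℚ < p → 0ℚ < q → recip p - recip q ≡ recip p * recip q * (q - p)
recip-diff {p} {q} 0<p 0<q = trans (sym (cong₂ _-_
    (trans (cong (recip p *_) (*-recip 0<q)) (ℚ.*-identityʳ (recip p)))
    (trans (cong (recip q *_) (*-recip 0<p)) (ℚ.*-identityʳ (recip q)))))
  (eq p q (recip p) (recip q))
  where
  eq : ∀ p q p′ q′ → p′ * (q * q′) - q′ * (p * p′) ≡ p′ * q′ * (q - p)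
  eq = solve 4 (λ p q p′ q′ → p′ :* (q :* q′) :- q′ :* (p :* p′) := p′ :* q′ :* (q :- p)) refl

recip-anti : ∀ {p q} → 0ℚ < p → p ≤ q → recip q ≤ recip p
recip-anti {p} {q} 0<p p≤q = ≤-from-gap (recip p * recip q * (q - p))
  (0≤* (0≤* (ℚ.<⇒≤ (0<recip 0<p)) (ℚ.<⇒≤ (0<recip 0<q))) (gap p≤q))
  (trans (eq (recip p) (recip q)) (cong (λ h → recip q + h) (recip-diff 0<p 0<q)))
  where
  0<q : 0ℚ < q
  0<q = ℚ.<-≤-trans 0<p p≤q
  eq : ∀ a b → a ≡ b + (a - b)
  eq = solve 2 (λ a b → a := b :+ (a :- b)) refl

recip-dist : ∀ p q {b δ} → 0ℚ < b → b ≤ p → b ≤ q → ∣ q - p ∣ ≤ δ →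
             ∣ recip p - recip q ∣ ≤ recip b * recip b * δ
recip-dist p q {b} 0<b b≤p b≤q h = ℚ.≤-trans
  (ℚ.≤-reflexive (trans (cong ∣_∣ (recip-diff 0<p 0<q))
    (trans (ℚ.∣p*q∣≡∣p∣*∣q∣ (recip p * recip q) (q - p))
      (cong (_* ∣ q - p ∣) (ℚ.0≤p⇒∣p∣≡p (0≤* 0≤p′ 0≤q′))))))
  (*-mono (0≤* 0≤p′ 0≤q′) (*-mono 0≤p′ (recip-anti 0<b b≤p) 0≤q′ (recip-anti 0<b b≤q)) (ℚ.0≤∣p∣ (q - p)) h)
  where
  0<p : 0ℚ < p
  0<p = ℚ.<-≤-trans 0<b b≤p
  0<q : 0ℚ < q
  0<q = ℚ.<-≤-trans 0<b b≤q
  0≤p′ : 0ℚ ≤ recip p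
  0≤p′ = ℚ.<⇒≤ (0<recip 0<p)
  0≤q′ : 0ℚ ≤ recip q
  0≤q′ = ℚ.<⇒≤ (0<recip 0<q)

Cauchy : (ℕ → ℚ) → Set
Cauchy s = ∀ {ε} → 0ℚ < ε → ∃[ N ] ∀ i j → N ℕ.≤ i → N ℕ.≤ j → ∣ s i - s j ∣ ≤ ε

-- Equality of reals is _≃_ below, not _≡_.
record ℝ : Set where
  constructor mkℝ
  field
    seq    : ℕ → ℚ
    cauchy : Cauchy seq

open ℝ public

infix 4 _≤ℝ_ _≃_

_≤ℝ_ : ℝ → ℝ → Set
x ≤ℝ y = ∀ {ε} → 0ℚ < ε → ∃[ N ] ∀ i → N ℕ.≤ i → seq x i ≤ seq y i + ε

_≃_ : ℝ → ℝ → Set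
x ≃ y = x ≤ℝ y × y ≤ℝ x

0<ℝ_ : ℝ → Set
0<ℝ x = ∃[ ε ] (0ℚ < ε × ∃[ N ] ∀ i → N ℕ.≤ i → ε ≤ seq x i)

ordered⇒Cauchy : ∀ {s} → (∀ {ε} → 0ℚ < ε → ∃[ N ] ∀ i j → N ℕ.≤ i → i ℕ.≤ j → ∣ s i - s j ∣ ≤ ε) → Cauchy s
ordered⇒Cauchy {s} h 0<ε with h 0<ε
... | N , k = N , λ i j N≤i N≤j → both i j N≤i N≤j (ℕ.≤-total i j)
  where
  both : ∀ i j → N ℕ.≤ i → N ℕ.≤ j → i ℕ.≤ j ⊎ j ℕ.≤ i → ∣ s i - s j ∣ ≤ _
  both i j N≤i N≤j (inj₁ i≤j) = k i j N≤i i≤j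
  both i j N≤i N≤j (inj₂ j≤i) = subst (_≤ _) (∣-∣-sym (s j) (s i)) (k j i N≤j j≤i)

eventually-bounded : ∀ {s} → Cauchy s → ∃[ b ] (0ℚ ≤ b × ∃[ N ] ∀ i → N ℕ.≤ i → ∣ s i ∣ ≤ b)
eventually-bounded {s} c with c 0<1
... | N , h = 1ℚ + ∣ s N ∣ , 0≤+ 0≤1 (ℚ.0≤∣p∣ (s N)) , N , λ i N≤i → ℚ.≤-trans
  (ℚ.≤-reflexive (cong ∣_∣ (solve 2 (λ a b → a := (a :- b) :+ b) refl (s i) (s N))))
  (ℚ.≤-trans (ℚ.∣p+q∣≤∣p∣+∣q∣ (s i - s N) (s N)) (ℚ.+-monoˡ-≤ ∣ s N ∣ (h i N N≤i ℕ.≤-refl)))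

fromℚ : ℚ → ℝ
fromℚ q = mkℝ (λ _ → q) λ 0<ε → 0 , λ _ _ _ _ →
  subst (λ d → ∣ d ∣ ≤ _) (sym (ℚ.+-inverseʳ q)) (ℚ.<⇒≤ 0<ε)

ℕ→ℝ : ℕ → ℝ
ℕ→ℝ n = fromℚ (fromℕ n)

infix  8 -ℝ_
infixl 7 _*ℝ_ _÷ℝ_
infixr 8 _^ℝ_

-ℝ_ : ℝ → ℝ
-ℝ x = mkℝ (λ i → - seq x i) λ 0<ε → let N , h = cauchy x 0<ε in
  N , λ i j N≤i N≤j → subst (_≤ _) (eq (seq x i) (seq x j)) (h i j N≤i N≤j)
  where
  eq : ∀ p q → ∣ p - q ∣ ≡ ∣ - p - - q ∣
  eq p q = trans (∣-∣-sym p q) (cong ∣_∣ (solve 2 (λ p q → q :- p := :- p :- (:- q)) refl p q))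

_*ℝ_ : ℝ → ℝ → ℝ
x *ℝ y = mkℝ (λ i → seq x i * seq y i) *-cauchy
  where
  *-cauchy : Cauchy (λ i → seq x i * seq y i)
  *-cauchy {ε} 0<ε =
    let b , 0≤b , Nb , hb = eventually-bounded {seq x} (cauchy x)
        c , 0≤c , Nc , hc = eventually-bounded {seq y} (cauchy y)
        β , 0<β , bβ≤ = shrink b 0≤b (halve 0<ε)
        γ , 0<γ , cγ≤ = shrink c 0≤c (halve 0<ε)
        Ny , hy = cauchy y 0<β
        Nx , hx = cauchy x 0<γ
    in (Nb ℕ.⊔ Nc) ℕ.⊔ (Ny ℕ.⊔ Nx) , λ i j N≤i N≤j →
      *-dist (seq x i) (seq x j) (seq y i) (seq y j)
             (hb i (ℕ.m⊔n≤o⇒m≤o Nb Nc (ℕ.m⊔n≤o⇒m≤o _ _ N≤i)))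
             (hc j (ℕ.m⊔n≤o⇒n≤o Nb Nc (ℕ.m⊔n≤o⇒m≤o _ _ N≤j)))
             (hx i j (ℕ.m⊔n≤o⇒n≤o Ny Nx (ℕ.m⊔n≤o⇒n≤o (Nb ℕ.⊔ Nc) _ N≤i))
                     (ℕ.m⊔n≤o⇒n≤o Ny Nx (ℕ.m⊔n≤o⇒n≤o (Nb ℕ.⊔ Nc) _ N≤j)))
             (hy i j (ℕ.m⊔n≤o⇒m≤o Ny Nx (ℕ.m⊔n≤o⇒n≤o (Nb ℕ.⊔ Nc) _ N≤i))
                     (ℕ.m⊔n≤o⇒m≤o Ny Nx (ℕ.m⊔n≤o⇒n≤o (Nb ℕ.⊔ Nc) _ N≤j)))
             bβ≤ cγ≤

-- seq x i may vanish for small i, where recip takes its default value.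
invℝ : (x : ℝ) → 0<ℝ x → ℝ
invℝ x (b , 0<b , Nb , hb) = mkℝ (λ i → recip (seq x i)) inv-cauchy
  where
  inv-cauchy : Cauchy (λ i → recip (seq x i))
  inv-cauchy {ε} 0<ε =
    let 0≤r = ℚ.<⇒≤ (0<recip 0<b)
        δ , 0<δ , h = shrink (recip b * recip b) (0≤* 0≤r 0≤r) 0<ε
        Nx , hx = cauchy x 0<δ
    in Nb ℕ.⊔ Nx , λ i j N≤i N≤j →
      ℚ.≤-trans (recip-dist (seq x i) (seq x j) 0<b (hb i (ℕ.m⊔n≤o⇒m≤o Nb Nx N≤i)) (hb j (ℕ.m⊔n≤o⇒m≤o Nb Nx N≤j))
                  (hx j i (ℕ.m⊔n≤o⇒n≤o Nb Nx N≤j) (ℕ.m⊔n≤o⇒n≤o Nb Nx N≤i))) h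

_÷ℝ_ : ℝ → Σ ℝ 0<ℝ_ → ℝ
x ÷ℝ (y , 0<y) = x *ℝ invℝ y 0<y

_^ℝ_ : ℝ → ℕ → ℝ
x ^ℝ zero  = fromℚ 1ℚ
x ^ℝ suc n = x *ℝ (x ^ℝ n)

expTerm : ℕ → ℚ → ℚ
expTerm k x = x ^ k * (+ 1 / (k !)) {{k ℕ.!≢0}}

-- expSum N x = Σ_{k ≤ N} x ^ k / k!
expSum : ℕ → ℚ → ℚ
expSum zero    x = expTerm 0 x
expSum (suc N) x = expSum N x + expTerm (suc N) x

fromℕ-*-1/ : ∀ n .{{_ : ℕ.NonZero n}} → fromℕ n * (+ 1 / n) ≡ 1ℚ
fromℕ-*-1/ n@(suc d) = ℚ.toℚᵘ-injective
  (ℚᵘ.≃-trans (ℚ.toℚᵘ-homo-* (fromℕ n) (+ 1 / n))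
  (ℚᵘ.≃-trans (ℚᵘ.*-cong (ℚ.toℚᵘ-fromℚᵘ (ℚᵘ.mkℚᵘ (+ n) 0)) (ℚ.toℚᵘ-fromℚᵘ (ℚᵘ.mkℚᵘ (+ 1) d)))
  (ℚᵘ.*≡* (cong +_ (eq d)))))
  where
  eq : ∀ d → suc d ℕ.* 1 ℕ.* 1 ≡ 1 ℕ.* (1 ℕ.* suc d)
  eq d = trans (ℕ.*-identityʳ (suc d ℕ.* 1)) (trans (ℕ.*-comm (suc d) 1) (sym (ℕ.*-identityˡ (1 ℕ.* suc d))))

expTerm-suc : ∀ k x → fromℕ (suc k) * expTerm (suc k) x ≡ x * expTerm k x
expTerm-suc k x = trans (eq₁ (fromℕ (suc k)) x (x ^ k) v′)
  (cong (λ h → x * (x ^ k * h)) (trans (sym (ℚ.*-identityʳ (fromℕ (suc k) * v′)))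
    (trans (cong (fromℕ (suc k) * v′ *_) (sym (fromℕ-*-1/ (k !) {{k ℕ.!≢0}})))
    (trans (eq₂ (fromℕ (suc k)) v′ (fromℕ (k !)) v)
    (trans (cong (λ h → h * v′ * v) (sym (fromℕ-* (suc k) (k !))))
    (trans (cong (_* v) (fromℕ-*-1/ (suc k !) {{suc k ℕ.!≢0}})) (ℚ.*-identityˡ v)))))))
  where
  v v′ : ℚ
  v  = (+ 1 / (k !)) {{k ℕ.!≢0}}
  v′ = (+ 1 / (suc k !)) {{suc k ℕ.!≢0}}
  eq₁ : ∀ n x y v → n * (x * y * v) ≡ x * (y * (n * v))
  eq₁ = solve 4 (λ n x y v → n :* (x :* y :* v) := x :* (y :* (n :* v))) refl
  eq₂ : ∀ a v b w → a * v * (b * w) ≡ a * b * v * w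
  eq₂ = solve 4 (λ a v b w → a :* v :* (b :* w) := a :* b :* v :* w) refl

fromℕ-cancel : ∀ k {p q} → fromℕ (suc k) * p ≤ fromℕ (suc k) * q → p ≤ q
fromℕ-cancel k = ℚ.*-cancelˡ-≤-pos (fromℕ (suc k)) {{ℚ.positive (0<fromℕ-suc k)}}

0≤expTerm : ∀ k {x} → 0ℚ ≤ x → 0ℚ ≤ expTerm k x
0≤expTerm zero    0≤x = ℚ.nonNegative⁻¹ (1ℚ * 1ℚ)
0≤expTerm (suc k) {x} 0≤x = fromℕ-cancel k (subst₂ _≤_ (sym (ℚ.*-zeroʳ (fromℕ (suc k)))) (sym (expTerm-suc k x))
  (0≤* 0≤x (0≤expTerm k 0≤x)))

expTerm-mono : ∀ k {x y} → 0ℚ ≤ x → x ≤ y → expTerm k x ≤ expTerm k y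
expTerm-mono zero    0≤x x≤y = ℚ.≤-refl
expTerm-mono (suc k) {x} {y} 0≤x x≤y = fromℕ-cancel k (subst₂ _≤_ (sym (expTerm-suc k x)) (sym (expTerm-suc k y))
  (*-mono 0≤x x≤y (0≤expTerm k 0≤x) (expTerm-mono k 0≤x x≤y)))

∣fromℕ*∣ : ∀ k p → ∣ fromℕ k * p ∣ ≡ fromℕ k * ∣ p ∣
∣fromℕ*∣ k p = trans (ℚ.∣p*q∣≡∣p∣*∣q∣ (fromℕ k) p) (cong (_* ∣ p ∣) (ℚ.0≤p⇒∣p∣≡p (0≤fromℕ k)))

∣expTerm∣≤ : ∀ k {x b} → ∣ x ∣ ≤ b → ∣ expTerm k x ∣ ≤ expTerm k b
∣expTerm∣≤ zero    h = ℚ.≤-refl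
∣expTerm∣≤ (suc k) {x} {b} h = fromℕ-cancel k (subst₂ _≤_
  (sym (trans (sym (∣fromℕ*∣ (suc k) (expTerm (suc k) x)))
    (trans (cong ∣_∣ (expTerm-suc k x)) (ℚ.∣p*q∣≡∣p∣*∣q∣ x (expTerm k x)))))
  (sym (expTerm-suc k b))
  (*-mono (ℚ.0≤∣p∣ x) h (ℚ.0≤∣p∣ (expTerm k x)) (∣expTerm∣≤ k h)))

0≤bound : ∀ {x b} → ∣ x ∣ ≤ b → 0ℚ ≤ b
0≤bound {x} h = ℚ.≤-trans (ℚ.0≤∣p∣ x) h

expTerm-lipschitz : ∀ k {x y b} → ∣ x ∣ ≤ b → ∣ y ∣ ≤ b →
                    ∣ expTerm (suc k) x - expTerm (suc k) y ∣ ≤ expTerm k b * ∣ x - y ∣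
expTerm-lipschitz k {x} {y} {b} hx hy = fromℕ-cancel k (subst₂ _≤_ (∣fromℕ*∣ (suc k) (t (suc k) x - t (suc k) y)) refl (go k))
  where
  t : ℕ → ℚ → ℚ
  t = expTerm
  d : ℚ
  d = ∣ x - y ∣
  eq₁ : ∀ n p q → n * (p - q) ≡ n * p - n * q
  eq₁ = solve 3 (λ n p q → n :* (p :- q) := n :* p :- n :* q) refl
  eq₂ : ∀ x p q → x * p - x * q ≡ x * (p - q)
  eq₂ = solve 3 (λ x p q → x :* p :- x :* q := x :* (p :- q)) refl
  eq₃ : ∀ x y q → x * q - y * q ≡ q * (x - y)
  eq₃ = solve 3 (λ x y q → x :* q :- y :* q := q :* (x :- y)) refl
  eq₄ : ∀ n t d → n * (t * d) + t * d ≡ (1ℚ + n) * (t * d)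
  eq₄ = solve 3 (λ n t d → n :* (t :* d) :+ t :* d := (con 1ℚ :+ n) :* (t :* d)) refl
  eq₅ : ∀ b p d → b * (p * d) ≡ b * p * d
  eq₅ = solve 3 (λ b p d → b :* (p :* d) := b :* p :* d) refl
  diff : ∀ k → ∣ t k x - t k y ∣ * b ≤ fromℕ k * (t k b * d)
  go : ∀ k → ∣ fromℕ (suc k) * (t (suc k) x - t (suc k) y) ∣ ≤ fromℕ (suc k) * (t k b * d)
  diff zero = ℚ.≤-reflexive (trans (cong (λ h → ∣ h ∣ * b) (ℚ.+-inverseʳ (t 0 x)))
    (trans (ℚ.*-zeroˡ b) (sym (ℚ.*-zeroˡ (t 0 b * d)))))
  diff (suc k) = ℚ.≤-trans (*-monoˡ b (0≤bound hx)
      (fromℕ-cancel k (subst₂ _≤_ (∣fromℕ*∣ (suc k) (t (suc k) x - t (suc k) y)) refl (go k))))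
    (ℚ.≤-reflexive (trans (eq₆ (t k b) d b) (trans (cong (_* d) (sym (expTerm-suc k b)))
      (sym (eq₅ (fromℕ (suc k)) (t (suc k) b) d)))))
    where
    eq₆ : ∀ t d b → t * d * b ≡ b * t * d
    eq₆ = solve 3 (λ t d b → t :* d :* b := b :* t :* d) refl
  go k = subst₂ _≤_
    (cong ∣_∣ (sym (trans (eq₁ (fromℕ (suc k)) (t (suc k) x) (t (suc k) y))
      (cong₂ _-_ (expTerm-suc k x) (expTerm-suc k y)))))
    (trans (eq₄ (fromℕ k) (t k b) d) (cong (_* (t k b * d)) (sym (fromℕ-suc k))))
    (∣-∣-via (x * t k x) (x * t k y) (y * t k y)
      (ℚ.≤-trans (ℚ.≤-reflexive (trans (cong ∣_∣ (eq₂ x (t k x) (t k y)))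
          (trans (ℚ.∣p*q∣≡∣p∣*∣q∣ x (t k x - t k y)) (ℚ.*-comm ∣ x ∣ ∣ t k x - t k y ∣))))
        (ℚ.≤-trans (*-monoʳ ∣ t k x - t k y ∣ (ℚ.0≤∣p∣ (t k x - t k y)) hx) (diff k)))
      (ℚ.≤-trans (ℚ.≤-reflexive (trans (cong ∣_∣ (eq₃ x y (t k y))) (ℚ.∣p*q∣≡∣p∣*∣q∣ (t k y) (x - y))))
        (*-monoˡ d (ℚ.0≤∣p∣ (x - y)) (∣expTerm∣≤ k hy))))

expSum-mono : ∀ {M N x} → 0ℚ ≤ x → M ℕ.≤ N → expSum M x ≤ expSum N x
expSum-mono {M} {x = x} 0≤x M≤N = go (ℕ.≤⇒≤′ M≤N)
  where
  go : ∀ {N} → M ℕ.≤′ N → expSum M x ≤ expSum N x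
  go ℕ.≤′-refl = ℚ.≤-refl
  go (ℕ.≤′-step {n = N} h) = ℚ.≤-trans (go h) (≤-from-gap (expTerm (suc N) x) (0≤expTerm (suc N) 0≤x) refl)

0≤expSum : ∀ N {x} → 0ℚ ≤ x → 0ℚ ≤ expSum N x
0≤expSum N 0≤x = ℚ.≤-trans (0≤expTerm 0 0≤x) (expSum-mono {0} {N} 0≤x ℕ.z≤n)

module Tail {b : ℚ} (0≤b : 0ℚ ≤ b) where

  -- From index K on, consecutive terms of the series at b at least halve.
  K : ℕ
  K = proj₁ (archimedean (b + b))

  t-halves : ∀ {k} → K ℕ.≤ k → expTerm (suc k) b + expTerm (suc k) b ≤ expTerm k b
  t-halves {k} K≤k = fromℕ-cancel k (subst₂ _≤_
    (sym (trans (ℚ.*-distribˡ-+ (fromℕ (suc k)) (expTerm (suc k) b) (expTerm (suc k) b))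
      (trans (cong₂ _+_ (expTerm-suc k b) (expTerm-suc k b)) (sym (ℚ.*-distribʳ-+ (expTerm k b) b b)))))
    refl
    (*-monoˡ (expTerm k b) (0≤expTerm k 0≤b)
      (ℚ.≤-trans (proj₂ (archimedean (b + b))) (fromℕ-mono (ℕ.m≤n⇒m≤1+n K≤k)))))

  t-step : ∀ {k} → K ℕ.≤ k → expTerm (suc k) b ≤ expTerm k b
  t-step {k} K≤k = ℚ.≤-trans
    (≤-from-gap (expTerm (suc k) b) (0≤expTerm (suc k) 0≤b) refl) (t-halves K≤k)

  t-anti : ∀ {M N} → K ℕ.≤ M → M ℕ.≤ N → expTerm N b ≤ expTerm M b
  t-anti {M} K≤M M≤N = go (ℕ.≤⇒≤′ M≤N)
    where
    go : ∀ {N} → M ℕ.≤′ N → expTerm N b ≤ expTerm M b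
    go ℕ.≤′-refl     = ℚ.≤-refl
    go (ℕ.≤′-step h) = ℚ.≤-trans (t-step (ℕ.≤-trans K≤M (ℕ.≤′⇒≤ h))) (go h)

  t-decay : ∀ j → fromℕ (suc j) * expTerm (j ℕ.+ K) b ≤ expTerm K b
  t-decay zero    = ℚ.≤-reflexive (ℚ.*-identityˡ (expTerm K b))
  t-decay (suc j) = ℚ.≤-trans (≤-from-gap (fromℕ j * u) (0≤* (0≤fromℕ j) (0≤expTerm (suc j ℕ.+ K) 0≤b))
      (trans (eq (fromℕ j) u) (cong (λ h → h * u + fromℕ j * u)
        (sym (trans (fromℕ-suc (suc j)) (cong (λ h → 1ℚ + h) (fromℕ-suc j)))))))
    (ℚ.≤-trans (*-monoʳ (1ℚ + fromℕ j) (0≤+ 0≤1 (0≤fromℕ j)) (t-halves (ℕ.m≤n+m K j)))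
      (subst (λ h → h * expTerm (j ℕ.+ K) b ≤ expTerm K b) (fromℕ-suc j) (t-decay j)))
    where
    u : ℚ
    u = expTerm (suc j ℕ.+ K) b
    eq : ∀ n u → (1ℚ + n) * (u + u) ≡ (1ℚ + (1ℚ + n)) * u + n * u
    eq = solve 2 (λ n u → (con 1ℚ :+ n) :* (u :+ u) := (con 1ℚ :+ (con 1ℚ :+ n)) :* u :+ n :* u) refl

  t-small : ∀ {ε} → 0ℚ < ε → ∃[ M ] (K ℕ.≤ M × expTerm M b ≤ ε)
  t-small {ε} 0<ε = let j , h = archimedean* (expTerm K b) 0<ε in
    j ℕ.+ K , ℕ.m≤n+m K j , fromℕ-cancel j (ℚ.≤-trans (t-decay j) h)

  tail : ∀ {M N} → K ℕ.≤ M → M ℕ.≤ N → expSum N b + expTerm N b ≤ expSum M b + expTerm M b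
  tail {M} K≤M M≤N = go (ℕ.≤⇒≤′ M≤N)
    where
    go : ∀ {N} → M ℕ.≤′ N → expSum N b + expTerm N b ≤ expSum M b + expTerm M b
    go ℕ.≤′-refl = ℚ.≤-refl
    go (ℕ.≤′-step {n = N} h) = ℚ.≤-trans
      (ℚ.≤-reflexive (ℚ.+-assoc (expSum N b) (expTerm (suc N) b) (expTerm (suc N) b)))
      (ℚ.≤-trans (ℚ.+-monoʳ-≤ (expSum N b) (t-halves (ℕ.≤-trans K≤M (ℕ.≤′⇒≤ h)))) (go h))

  tail′ : ∀ {M N} → K ℕ.≤ M → M ℕ.≤ N → expSum N b ≤ expSum M b + expTerm M b
  tail′ {M} {N} K≤M M≤N = ℚ.≤-trans (≤-from-gap (expTerm N b) (0≤expTerm N 0≤b) refl) (tail K≤M M≤N)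

  ∣tail∣ : ∀ {x M N} → ∣ x ∣ ≤ b → K ℕ.≤ M → M ℕ.≤ N → ∣ expSum N x - expSum M x ∣ ≤ expTerm M b
  ∣tail∣ {x} {M} {N} hx K≤M M≤N = ℚ.≤-trans (go (ℕ.≤⇒≤′ M≤N))
    (≤-from-gap (expSum M b + expTerm M b - expSum N b) (gap (tail′ K≤M M≤N))
      (eq₁ (expSum M b) (expSum N b) (expTerm M b)))
    where
    eq₁ : ∀ m n t → t ≡ n - m + (m + t - n)
    eq₁ = solve 3 (λ m n t → t := n :- m :+ (m :+ t :- n)) refl
    eq₂ : ∀ p q r → p + r - q ≡ p - q + r
    eq₂ = solve 3 (λ p q r → p :+ r :- q := p :- q :+ r) refl
    go : ∀ {N} → M ℕ.≤′ N → ∣ expSum N x - expSum M x ∣ ≤ expSum N b - expSum M b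
    go ℕ.≤′-refl = ℚ.≤-reflexive (trans (cong ∣_∣ (ℚ.+-inverseʳ (expSum M x))) (sym (ℚ.+-inverseʳ (expSum M b))))
    go (ℕ.≤′-step {n = N} h) = subst₂ _≤_
      (cong ∣_∣ (sym (eq₂ (expSum N x) (expSum M x) (expTerm (suc N) x))))
      (sym (eq₂ (expSum N b) (expSum M b) (expTerm (suc N) b)))
      (ℚ.≤-trans (ℚ.∣p+q∣≤∣p∣+∣q∣ (expSum N x - expSum M x) (expTerm (suc N) x))
        (ℚ.+-mono-≤ (go h) (∣expTerm∣≤ (suc N) hx)))

  -- An upper bound for all partial sums at b.
  S : ℚ
  S = expSum K b + expTerm K b

  0≤S : 0ℚ ≤ S
  0≤S = 0≤+ (0≤expSum K 0≤b) (0≤expTerm K 0≤b)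

  ≤S : ∀ N → expSum N b ≤ S
  ≤S N with ℕ.≤-total K N
  ... | inj₁ K≤N = tail′ ℕ.≤-refl K≤N
  ... | inj₂ N≤K = ℚ.≤-trans (expSum-mono {N} {K} 0≤b N≤K)
                     (≤-from-gap (expTerm K b) (0≤expTerm K 0≤b) refl)

  lipschitz : ∀ N {x y} → ∣ x ∣ ≤ b → ∣ y ∣ ≤ b → ∣ expSum N x - expSum N y ∣ ≤ S * ∣ x - y ∣
  lipschitz zero {x} {y} hx hy = ℚ.≤-trans (ℚ.≤-reflexive (cong ∣_∣ (ℚ.+-inverseʳ (expTerm 0 x))))
    (0≤* 0≤S (ℚ.0≤∣p∣ (x - y)))
  lipschitz (suc N) {x} {y} hx hy = ℚ.≤-trans (go N) (*-monoˡ ∣ x - y ∣ (ℚ.0≤∣p∣ (x - y)) (≤S N))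
    where
    eq : ∀ p q r s → p + q - (r + s) ≡ (p - r) + (q - s)
    eq = solve 4 (λ p q r s → p :+ q :- (r :+ s) := (p :- r) :+ (q :- s)) refl
    step : ∀ N {c} → ∣ expSum N x - expSum N y ∣ ≤ c →
           ∣ expSum (suc N) x - expSum (suc N) y ∣ ≤ c + expTerm N b * ∣ x - y ∣
    step N {c} h = ℚ.≤-trans
      (ℚ.≤-reflexive (cong ∣_∣ (eq (expSum N x) (expTerm (suc N) x) (expSum N y) (expTerm (suc N) y))))
      (ℚ.≤-trans (ℚ.∣p+q∣≤∣p∣+∣q∣ (expSum N x - expSum N y) (expTerm (suc N) x - expTerm (suc N) y))
        (ℚ.+-mono-≤ h (expTerm-lipschitz N hx hy)))
    go : ∀ N → ∣ expSum (suc N) x - expSum (suc N) y ∣ ≤ expSum N b * ∣ x - y ∣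
    go zero = ℚ.≤-trans (step 0 {0ℚ} (ℚ.≤-reflexive (cong ∣_∣ (ℚ.+-inverseʳ (expTerm 0 x)))))
      (ℚ.≤-reflexive (ℚ.+-identityˡ (expTerm 0 b * ∣ x - y ∣)))
    go (suc N) = ℚ.≤-trans (step (suc N) (go N))
      (ℚ.≤-reflexive (sym (ℚ.*-distribʳ-+ ∣ x - y ∣ (expSum N b) (expTerm (suc N) b))))

exp : ℝ → ℝ
exp x = mkℝ (λ i → expSum i (seq x i)) exp-cauchy
  where
  exp-cauchy : Cauchy (λ i → expSum i (seq x i))
  exp-cauchy = ordered⇒Cauchy {λ i → expSum i (seq x i)} λ {ε} 0<ε →
    let b , 0≤b , Nb , hb = eventually-bounded {seq x} (cauchy x)
        open Tail 0≤b
        δ , 0<δ , Sδ≤ = shrink S 0≤S (halve 0<ε)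
        Nx , hx = cauchy x 0<δ
        M , K≤M , t≤ = t-small (halve 0<ε)
    in (Nb ℕ.⊔ Nx) ℕ.⊔ M , λ i j N≤i i≤j →
      let Nb≤i = ℕ.m⊔n≤o⇒m≤o Nb Nx (ℕ.m⊔n≤o⇒m≤o _ M N≤i)
          Nx≤i = ℕ.m⊔n≤o⇒n≤o Nb Nx (ℕ.m⊔n≤o⇒m≤o _ M N≤i)
          M≤i  = ℕ.m⊔n≤o⇒n≤o (Nb ℕ.⊔ Nx) M N≤i
          hj   = hb j (ℕ.≤-trans Nb≤i i≤j)
      in subst (∣ expSum i (seq x i) - expSum j (seq x j) ∣ ≤_) (halves ε)
        (∣-∣-via (expSum i (seq x i)) (expSum i (seq x j)) (expSum j (seq x j))
          (ℚ.≤-trans (lipschitz i (hb i Nb≤i) hj)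
            (ℚ.≤-trans (*-monoʳ S 0≤S (hx i j Nx≤i (ℕ.≤-trans Nx≤i i≤j))) Sδ≤))
          (ℚ.≤-trans (ℚ.≤-reflexive (∣-∣-sym (expSum i (seq x j)) (expSum j (seq x j))))
            (ℚ.≤-trans (∣tail∣ hj (ℕ.≤-trans K≤M M≤i) i≤j)
              (ℚ.≤-trans (t-anti K≤M M≤i) t≤))))

e : ℝ
e = exp (fromℚ 1ℚ)

0<e : 0<ℝ e
0<e = 1ℚ , 0<1 , 0 , λ i _ → expSum-mono {0} {i} 0≤1 ℕ.z≤n

expSum-gap : ∀ N {p q} → 0ℚ ≤ p → p ≤ q → expSum (suc N) p + (q - p) ≤ expSum (suc N) q
expSum-gap zero {p} {q} 0≤p p≤q = ℚ.≤-reflexive (eq p q)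
  where
  eq : ∀ p q → 1ℚ + p * 1ℚ * 1ℚ + (q - p) ≡ 1ℚ + q * 1ℚ * 1ℚ
  eq = solve 2 (λ p q → con 1ℚ :+ p :* con 1ℚ :* con 1ℚ :+ (q :- p) := con 1ℚ :+ q :* con 1ℚ :* con 1ℚ) refl
expSum-gap (suc N) {p} {q} 0≤p p≤q = ℚ.≤-trans
  (ℚ.≤-reflexive (eq (expSum (suc N) p) (expTerm (suc (suc N)) p) (q - p)))
  (ℚ.+-mono-≤ (expSum-gap N 0≤p p≤q) (expTerm-mono (suc (suc N)) 0≤p p≤q))
  where
  eq : ∀ s t d → s + t + d ≡ s + d + t
  eq = solve 3 (λ s t d → s :+ t :+ d := s :+ d :+ t) refl

⅓ ⅔ : ℚ
⅓ = + 1 / 3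
⅔ = + 2 / 3

-- For x ≥ 1, the solution y ∈ [0, x] of exp y = x, by trisection: it always
-- lies in [low j, low j + width j].  Halving the interval instead would need
-- an exact comparison of x with exp of the midpoint.
module Log (x : ℚ) (1≤x : 1ℚ ≤ x) where

  0<x : 0ℚ < x
  0<x = ℚ.<-≤-trans 0<1 1≤x

  0≤x : 0ℚ ≤ x
  0≤x = ℚ.<⇒≤ 0<x

  open Tail 0≤x

  width : ℕ → ℚ
  width zero    = x
  width (suc j) = ⅔ * width j

  0<width : ∀ j → 0ℚ < width j
  0<width zero    = 0<x
  0<width (suc j) = 0<* (ℚ.positive⁻¹ ⅔) (0<width j)

  0<⅓width : ∀ j → 0ℚ < ⅓ * width j
  0<⅓width j = 0<* (ℚ.positive⁻¹ ⅓) (0<width j)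

  -- The remainder of the exponential series after index suc (index j) is at
  -- most a third of width j on [0, x].
  index : ℕ → ℕ
  index j = proj₁ (t-small (0<⅓width j))

  low : ℕ → ℚ
  low zero    = 0ℚ
  low (suc j) = if ⌊ x ≤? expSum (suc (index j)) (low j + ⅔ * width j) ⌋
                then low j else low j + ⅓ * width j

  record Invariant (l w : ℚ) : Set where
    field
      0≤l   : 0ℚ ≤ l
      l+w≤x : l + w ≤ x
      lower : ∀ M → expSum M l ≤ x
      upper : ∃[ N ] x ≤ expSum N (l + w)

  thirds : ∀ l w → l + ⅓ * w + ⅔ * w ≡ l + w
  thirds = solve 2 (λ l w → l :+ con ⅓ :* w :+ con ⅔ :* w := l :+ w) refl

  third : ∀ l w → l + ⅔ * w - (l + ⅓ * w) ≡ ⅓ * w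
  third = solve 2 (λ l w → l :+ con ⅔ :* w :- (l :+ con ⅓ :* w) := con ⅓ :* w) refl

  two-thirds : ∀ l w → l + w ≡ l + ⅔ * w + ⅓ * w
  two-thirds = solve 2 (λ l w → l :+ w := l :+ con ⅔ :* w :+ con ⅓ :* w) refl

  expSum-0 : ∀ M → expSum M 0ℚ ≤ 1ℚ
  expSum-0 zero    = ℚ.≤-refl
  expSum-0 (suc M) = ℚ.+-mono-≤ (expSum-0 M) (fromℕ-cancel M (ℚ.≤-reflexive
    (trans (expTerm-suc M 0ℚ) (trans (ℚ.*-zeroˡ (expTerm M 0ℚ)) (sym (ℚ.*-zeroʳ (fromℕ (suc M))))))))

  invariant-zero : Invariant 0ℚ x
  invariant-zero = record
    { 0≤l   = ℚ.≤-refl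
    ; l+w≤x = ℚ.≤-reflexive (ℚ.+-identityˡ x)
    ; lower = λ M → ℚ.≤-trans (expSum-0 M) 1≤x
    ; upper = 1 , ≤-from-gap 1ℚ 0≤1 (eq x)
    }
    where
    eq : ∀ x → 1ℚ + (0ℚ + x) * 1ℚ * 1ℚ ≡ x + 1ℚ
    eq = solve 1 (λ x → con 1ℚ :+ (con 0ℚ :+ x) :* con 1ℚ :* con 1ℚ := x :+ con 1ℚ) refl

  ∣p∣≤x : ∀ {p} → 0ℚ ≤ p → p ≤ x → ∣ p ∣ ≤ x
  ∣p∣≤x 0≤p p≤x = subst (_≤ x) (sym (ℚ.0≤p⇒∣p∣≡p 0≤p)) p≤x

  expSum-≤ : ∀ {p} M N → 0ℚ ≤ p → p ≤ x → K ℕ.≤ N → expSum M p ≤ expSum N p + expTerm N x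
  expSum-≤ {p} M N 0≤p p≤x K≤N with ℕ.≤-total M N
  ... | inj₁ M≤N = ℚ.≤-trans (expSum-mono {M} {N} 0≤p M≤N) (≤-from-gap (expTerm N x) (0≤expTerm N 0≤x) refl)
  ... | inj₂ N≤M = ℚ.≤-trans (ℚ.≤-reflexive (eq (expSum M p) (expSum N p)))
      (ℚ.+-monoʳ-≤ (expSum N p) (ℚ.≤-trans (p≤∣p∣ (expSum M p - expSum N p)) (∣tail∣ (∣p∣≤x 0≤p p≤x) K≤N N≤M)))
    where
    eq : ∀ a b → a ≡ b + (a - b)
    eq = solve 2 (λ a b → a := b :+ (a :- b)) refl

  invariant-step : ∀ {l w} N → 0ℚ < w → K ℕ.≤ suc N → expTerm (suc N) x ≤ ⅓ * w → Invariant l w →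
    (d : Dec (x ≤ expSum (suc N) (l + ⅔ * w))) →
    Invariant (if ⌊ d ⌋ then l else l + ⅓ * w) (⅔ * w)
  invariant-step {l} {w} N 0<w K≤N t≤ inv (yes h) = record
    { 0≤l   = 0≤l
    ; l+w≤x = ℚ.≤-trans (≤-from-gap (⅓ * w) (0≤* (ℚ.nonNegative⁻¹ ⅓) (ℚ.<⇒≤ 0<w)) (two-thirds l w)) l+w≤x
    ; lower = lower
    ; upper = suc N , h
    }
    where open Invariant inv
  invariant-step {l} {w} N 0<w K≤N t≤ inv (no h) = record
    { 0≤l   = 0≤p
    ; l+w≤x = subst (_≤ x) (sym (thirds l w)) l+w≤x
    ; lower = λ M → ℚ.≤-trans (expSum-≤ M (suc N) 0≤p p≤x K≤N)
        (ℚ.≤-trans (ℚ.+-monoʳ-≤ (expSum (suc N) p) t≤)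
        (ℚ.≤-trans (ℚ.≤-reflexive (cong (λ h → expSum (suc N) p + h) (sym (third l w))))
        (ℚ.≤-trans (expSum-gap N 0≤p p≤q) (ℚ.<⇒≤ (ℚ.≰⇒> h)))))
    ; upper = proj₁ upper , subst (λ h → x ≤ expSum (proj₁ upper) h) (sym (thirds l w)) (proj₂ upper)
    }
    where
    open Invariant inv
    p q : ℚ
    p = l + ⅓ * w
    q = l + ⅔ * w
    0≤⅓w : 0ℚ ≤ ⅓ * w
    0≤⅓w = 0≤* (ℚ.nonNegative⁻¹ ⅓) (ℚ.<⇒≤ 0<w)
    0≤p : 0ℚ ≤ p
    0≤p = 0≤+ 0≤l 0≤⅓w
    p≤x : p ≤ x
    p≤x = ℚ.≤-trans (≤-from-gap (⅔ * w) (0≤* (ℚ.nonNegative⁻¹ ⅔) (ℚ.<⇒≤ 0<w)) (sym (thirds l w))) l+w≤x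
    p≤q : p ≤ q
    p≤q = ≤-from-gap (⅓ * w) 0≤⅓w (eq l w)
      where
      eq : ∀ l w → l + ⅔ * w ≡ l + ⅓ * w + ⅓ * w
      eq = solve 2 (λ l w → l :+ con ⅔ :* w := l :+ con ⅓ :* w :+ con ⅓ :* w) refl

  invariant : ∀ j → Invariant (low j) (width j)
  invariant zero    = invariant-zero
  invariant (suc j) =
    let K≤N , t≤ = proj₂ (t-small (0<⅓width j))
    in invariant-step (index j) (0<width j) (ℕ.m≤n⇒m≤1+n K≤N) (ℚ.≤-trans (t-step K≤N) t≤) (invariant j)
         (x ≤? expSum (suc (index j)) (low j + ⅔ * width j))

  nested : ∀ {l w} → 0ℚ < w → ∀ c → l ≤ (if c then l else l + ⅓ * w) ×
           (if c then l else l + ⅓ * w) + ⅔ * w ≤ l + w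
  nested {l} {w} 0<w true  = ℚ.≤-refl , ≤-from-gap (⅓ * w) (0≤* (ℚ.nonNegative⁻¹ ⅓) (ℚ.<⇒≤ 0<w)) (two-thirds l w)
  nested {l} {w} 0<w false = ≤-from-gap (⅓ * w) (0≤* (ℚ.nonNegative⁻¹ ⅓) (ℚ.<⇒≤ 0<w)) refl , ℚ.≤-reflexive (thirds l w)

  low-nested : ∀ {i j} → i ℕ.≤ j → low i ≤ low j × low j + width j ≤ low i + width i
  low-nested {i} i≤j = go (ℕ.≤⇒≤′ i≤j)
    where
    go : ∀ {j} → i ℕ.≤′ j → low i ≤ low j × low j + width j ≤ low i + width i
    go ℕ.≤′-refl = ℚ.≤-refl , ℚ.≤-refl
    go (ℕ.≤′-step {n = j} h) =
      let a , b = go h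
          c , d = nested {low j} (0<width j) ⌊ x ≤? expSum (suc (index j)) (low j + ⅔ * width j) ⌋
      in ℚ.≤-trans a c , ℚ.≤-trans d b

  width-decay : ∀ j → fromℕ (suc (suc j)) * width j ≤ x + x
  width-decay zero    = ℚ.≤-reflexive (eq x)
    where
    eq : ∀ x → (1ℚ + 1ℚ) * x ≡ x + x
    eq = solve 1 (λ x → (con 1ℚ :+ con 1ℚ) :* x := x :+ x) refl
  width-decay (suc j) = ℚ.≤-trans (≤-from-gap (⅓ * (fromℕ j * width j))
      (0≤* (ℚ.nonNegative⁻¹ ⅓) (0≤* (0≤fromℕ j) (ℚ.<⇒≤ (0<width j))))
      (subst₂ (λ m n → n * width j ≡ m * (⅔ * width j) + ⅓ * (fromℕ j * width j))
        (sym (trans (fromℕ-suc (suc (suc j))) (cong (λ h → 1ℚ + h) 2+j))) (sym 2+j)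
        (eq (fromℕ j) (width j))))
    (width-decay j)
    where
    2+j : fromℕ (suc (suc j)) ≡ 1ℚ + (1ℚ + fromℕ j)
    2+j = trans (fromℕ-suc (suc j)) (cong (λ h → 1ℚ + h) (fromℕ-suc j))
    eq : ∀ n w → (1ℚ + (1ℚ + n)) * w ≡ (1ℚ + (1ℚ + (1ℚ + n))) * (⅔ * w) + ⅓ * (n * w)
    eq = solve 2 (λ n w → (con 1ℚ :+ (con 1ℚ :+ n)) :* w :=
      (con 1ℚ :+ (con 1ℚ :+ (con 1ℚ :+ n))) :* (con ⅔ :* w) :+ con ⅓ :* (n :* w)) refl

  width-step : ∀ j → width (suc j) ≤ width j
  width-step j = ≤-from-gap (⅓ * width j) (ℚ.<⇒≤ (0<⅓width j)) (eq (width j))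
    where
    eq : ∀ w → w ≡ ⅔ * w + ⅓ * w
    eq = solve 1 (λ w → w := con ⅔ :* w :+ con ⅓ :* w) refl

  width-small : ∀ {ε} → 0ℚ < ε → ∃[ N ] ∀ i → N ℕ.≤ i → width i ≤ ε
  width-small {ε} 0<ε = let j , h = archimedean* (x + x) 0<ε in
    j , λ i j≤i → ℚ.≤-trans (anti (ℕ.≤⇒≤′ j≤i))
      (fromℕ-cancel (suc j) (ℚ.≤-trans (width-decay j)
        (ℚ.≤-trans h (*-monoˡ ε (ℚ.<⇒≤ 0<ε) (fromℕ-mono (ℕ.n≤1+n (suc j)))))))
    where
    anti : ∀ {j i} → j ℕ.≤′ i → width i ≤ width j
    anti ℕ.≤′-refl             = ℚ.≤-refl
    anti (ℕ.≤′-step {n = i} h) = ℚ.≤-trans (width-step i) (anti h)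

  low-cauchy : Cauchy low
  low-cauchy = ordered⇒Cauchy {low} λ 0<ε → let N , h = width-small 0<ε in
    N , λ i j N≤i i≤j → ℚ.≤-trans (near i≤j) (h i N≤i)
    where
    eq₁ : ∀ a b → a ≡ - (b - a) + b
    eq₁ = solve 2 (λ a b → a := :- (b :- a) :+ b) refl
    eq₂ : ∀ a b w → w ≡ - (a - b) + (a + w - b)
    eq₂ = solve 3 (λ a b w → w := :- (a :- b) :+ (a :+ w :- b)) refl
    eq₃ : ∀ a b w → w ≡ a - b + (w + (b - a))
    eq₃ = solve 3 (λ a b w → w := a :- b :+ (w :+ (b :- a))) refl
    near : ∀ {i j} → i ℕ.≤ j → ∣ low i - low j ∣ ≤ width i
    near {i} {j} i≤j = let a , b = low-nested i≤j in ∣∣-≤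
      (≤-from-gap (width i + (low j - low i)) (0≤+ (ℚ.<⇒≤ (0<width i)) (gap a)) (eq₃ (low i) (low j) (width i)))
      (≤-from-gap (low i + width i - low j)
        (gap (ℚ.≤-trans (≤-from-gap (width j) (ℚ.<⇒≤ (0<width j)) refl) b))
        (eq₂ (low i) (low j) (width i)))

  solution : ℝ
  solution = mkℝ low low-cauchy

  exp-solution : exp solution ≃ fromℚ x
  exp-solution = (λ {ε} 0<ε → 0 , λ i _ →
      ℚ.≤-trans (Invariant.lower (invariant i) i) (≤-from-gap ε (ℚ.<⇒≤ 0<ε) refl))
    , λ {ε} 0<ε →
      let δ , 0<δ , Sδ≤ = shrink S 0≤S (halve 0<ε)
          N , hw = width-small 0<δ
          M , K≤M , t≤ = t-small (halve 0<ε)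
      in N ℕ.⊔ M , λ i h →
        let N≤i = ℕ.m⊔n≤o⇒m≤o N M h
            M≤i = ℕ.m⊔n≤o⇒n≤o N M h
        in above i (ℕ.≤-trans K≤M M≤i) (ℚ.≤-trans (t-anti K≤M M≤i) t≤)
             (ℚ.≤-trans (*-monoʳ S 0≤S (hw i N≤i)) Sδ≤)
    where
    above : ∀ i {ε} → K ℕ.≤ i → expTerm i x ≤ ½ * ε → S * width i ≤ ½ * ε → x ≤ expSum i (low i) + ε
    above i {ε} K≤i t≤ s≤ = ℚ.≤-trans (proj₂ upper) (ℚ.≤-trans step₁ step₂)
      where
      open Invariant (invariant i)
      N : ℕ
      N = proj₁ upper
      0≤w : 0ℚ ≤ width i
      0≤w = ℚ.<⇒≤ (0<width i)
      l≤x : low i ≤ x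
      l≤x = ℚ.≤-trans (≤-from-gap (width i) 0≤w refl) l+w≤x
      cancel : ∀ l w → l + w - l ≡ w
      cancel = solve 2 (λ l w → l :+ w :- l := w) refl
      split : ∀ a b → a ≡ b + (a - b)
      split = solve 2 (λ a b → a := b :+ (a :- b)) refl
      step₁ : expSum N (low i + width i) ≤ expSum N (low i) + ½ * ε
      step₁ = ℚ.≤-trans (ℚ.≤-reflexive (split (expSum N (low i + width i)) (expSum N (low i))))
        (ℚ.+-monoʳ-≤ (expSum N (low i)) (ℚ.≤-trans (p≤∣p∣ (expSum N (low i + width i) - expSum N (low i)))
          (ℚ.≤-trans (lipschitz N (∣p∣≤x (0≤+ 0≤l 0≤w) l+w≤x) (∣p∣≤x 0≤l l≤x))
          (subst (λ h → S * h ≤ ½ * ε)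
            (sym (trans (cong ∣_∣ (cancel (low i) (width i))) (ℚ.0≤p⇒∣p∣≡p 0≤w))) s≤))))
      step₂ : expSum N (low i) + ½ * ε ≤ expSum i (low i) + ε
      step₂ = ℚ.≤-trans (ℚ.+-monoˡ-≤ (½ * ε) (ℚ.≤-trans (expSum-≤ N i 0≤l l≤x K≤i) (ℚ.+-monoʳ-≤ (expSum i (low i)) t≤)))
        (ℚ.≤-reflexive (eq (expSum i (low i)) ε))
        where
        eq : ∀ s e → s + ½ * e + ½ * e ≡ s + e
        eq = solve 2 (λ s e → s :+ con ½ :* e :+ con ½ :* e := s :+ e) refl

-- log x = - log (1/x) for 0 < x < 1, and log x = 0 by convention for x ≤ 0.
log : ℚ → ℝ
log x with 1ℚ ≤? x | 0ℚ <? x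
... | yes 1≤x | _       = Log.solution x 1≤x
... | no  1≰x | yes 0<x = -ℝ Log.solution (recip x) (recip-anti 0<x (ℚ.<⇒≤ (ℚ.≰⇒> 1≰x)))
... | no  _   | no  _   = fromℚ 0ℚ

exp-log : ∀ {x} → 1ℚ ≤ x → exp (log x) ≃ fromℚ x
exp-log {x} 1≤x with 1ℚ ≤? x | 0ℚ <? x
... | yes 1≤x′ | _ = Log.exp-solution x 1≤x′
... | no  1≰x  | _ = contradiction 1≤x 1≰x

infixr 8 _^ʳ_

-- Meant for x > 0 only, as is log.
_^ʳ_ : ℚ → ℝ → ℝ
x ^ʳ y = exp (y *ℝ log x)

record Graph : Set₁ where
  field
    Vertex    : Set
    _≟ᵛ_      : DecidableEquality Vertex
    vertices  : List Vertex
    complete  : ∀ v → v ∈ vertices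
    unique    : Unique vertices
    Adj       : Vertex → Vertex → Set
    adj?      : Decidable Adj
    symmetric : ∀ {u v} → Adj u v → Adj v u
    loopless  : ∀ {v} → ¬ Adj v v

open Graph

VertexSet : Graph → Set
VertexSet G = Vertex G → Bool

Nonempty : ∀ G → VertexSet G → Set
Nonempty G A = ∃[ v ] T (A v)

card : ∀ G → VertexSet G → ℕ
card G A = length (filterᵇ A (vertices G))

-- e_G(A, Aᶜ): an edge with exactly one endpoint in A is counted once, as the
-- pair (u , v) with u its endpoint in A and v the other one.
boundary : ∀ G → VertexSet G → ℕ
boundary G A = length (filterᵇ (λ (u , v) → A u ∧ not (A v) ∧ ⌊ adj? G u v ⌋)
                               (cartesianProduct (vertices G) (vertices G)))

Path : ℕ → Graph
Path m = record
  { Vertex    = Fin m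
  ; _≟ᵛ_      = Fin._≟_
  ; vertices  = allFin m
  ; complete  = ∈-allFin
  ; unique    = Unique.allFin⁺ m
  ; Adj       = λ i j → suc (toℕ i) ≡ toℕ j ⊎ suc (toℕ j) ≡ toℕ i
  ; adj?      = λ i j → (suc (toℕ i) ℕ.≟ toℕ j) ⊎-dec (suc (toℕ j) ℕ.≟ toℕ i)
  ; symmetric = λ { (inj₁ h) → inj₂ h ; (inj₂ h) → inj₁ h }
  ; loopless  = λ { (inj₁ h) → ℕ.1+n≢n h ; (inj₂ h) → ℕ.1+n≢n h }
  }

module _ {V : Set} (vs : List V) where

  vectors : ∀ n → List (Vec V n)
  vectors zero    = [] ∷ []
  vectors (suc n) = cartesianProductWith _∷_ vs (vectors n)

  vectors-complete : (∀ v → v ∈ vs) → ∀ {n} (u : Vec V n) → u ∈ vectors n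
  vectors-complete c []      = here refl
  vectors-complete c (v ∷ u) = ∈-cartesianProductWith⁺ _∷_ (c v) (vectors-complete c u)

  vectors-unique : Unique vs → ∀ n → Unique (vectors n)
  vectors-unique h zero    = [] ∷ []
  vectors-unique h (suc n) = Unique.cartesianProductWith⁺ _∷_ Vec.∷-injective h (vectors-unique h n)

infix 8 _□^_

_□^_ : Graph → ℕ → Graph
G □^ n = record
  { Vertex    = Vec (Vertex G) n
  ; _≟ᵛ_      = Vec.≡-dec (_≟ᵛ_ G)
  ; vertices  = vectors (vertices G) n
  ; complete  = vectors-complete (vertices G) (complete G)
  ; unique    = vectors-unique (vertices G) (unique G) n
  ; Adj       = λ u v → ∃[ j ] (Adj G (lookup u j) (lookup v j) × ∀ l → l ≢ j → lookup u l ≡ lookup v l)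
  ; adj?      = λ u v → Fin.any? λ j → adj? G (lookup u j) (lookup v j) ×-dec
                  Fin.all? λ l → ¬? (l Fin.≟ j) →-dec _≟ᵛ_ G (lookup u l) (lookup v l)
  ; symmetric = λ (j , a , h) → j , symmetric G a , λ l l≢j → sym (h l l≢j)
  ; loopless  = λ (j , a , _) → loopless G a
  }

{-# OPTIONS --safe #-}

-- Write ln for the logarithm and N = |A|.  If W ≥ 0 and τ ≤ ln m are reals with
-- N (τ + ln M - ln N) ≤ W M for all M, N ≥ 1, then n N τ ≤ W e(A, Aᶜ) + N ln N for
-- every A ⊆ [m]ⁿ.  This goes by induction on n: if the slices of A have sizes Nᵢ, with
-- maximum M and minimum c, then e(A, Aᶜ) ≥ Σ e(Aᵢ, Aᵢᶜ) + M - c, and the logarithms are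
-- compared by tangents of exp only.  The choice W = N^(1/n), τ = 1 + (ln N) / n, which
-- needs N ≤ (m/e)ⁿ, gives the first inequality, and W = m/e, τ = ln m the second.
module Submission where

open import Defs
open import Data.Bool using (Bool; true; false; T; not; _∧_)
open import Data.Bool.Properties using (T-∧)
open import Data.Fin using (Fin; zero; suc)
open import Data.Nat as ℕ using (ℕ; zero; suc; _≤_; _^_)
import Data.Nat.Properties as ℕ
open import Data.List using (List; []; _∷_; _++_; map; length; allFin; filterᵇ; cartesianProduct; cartesianProductWith)
open import Data.List.Extrema ℕ.≤-totalOrder using (argmax; argmin; f[xs]≤f[argmax]; f[argmin]≤f[xs])
open import Data.List.Membership.Propositional using (_∈_)
open import Data.List.Membership.Propositional.Properties using (∈-allFin)
import Data.List.Properties as List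
import Data.List.Relation.Unary.All as All
open import Data.List.Relation.Unary.Any using (here; there)
open import Data.Nat.Tactic.RingSolver using (solve-∀)
open import Data.Product using (Σ; _×_; _,_; proj₁; proj₂)
open import Data.Rational as ℚ using (ℚ; 0ℚ; 1ℚ; ½; _+_; _*_; _-_; -_; ∣_∣)
open import Data.Rational.Properties using (_≤?_; _<?_)
import Data.Rational.Properties as ℚ
open import Data.Rational.Solver using (module +-*-Solver)
open import Data.Sum using (_⊎_; inj₁; inj₂; [_,_]′)
open import Data.Vec using (Vec; []; _∷_)
open import Function using (_∘_; id)
open import Function.Bundles using (Equivalence)
open import Relation.Binary.PropositionalEquality using (_≡_; refl; sym; trans; cong; cong₂; subst; subst₂)
open import Relation.Nullary using (yes; no; contradiction)
open import Relation.Nullary.Decidable using (⌊_⌋; toWitness; fromWitness)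

open +-*-Solver using (solve; _:+_; _:*_; _:-_; _:=_; :-_; con)

-- Divided by M, the first hypothesis on W and τ reads x (τ - ln x) ≤ W with x = N / M. Its left
-- side is largest at ln x = τ - 1, so the best τ for a given W is 1 + ln W. With t = ln W and N =
-- |A| the conclusion becomes e(A, Aᶜ) ≥ N (n + n t - ln N) e^(-t). The right side increases up to t
-- = (ln N) / n and decreases afterwards, while τ ≤ ln m confines t to t ≤ ln m - 1. Hence the
-- optimum is W = N^(1/n) if N ≤ (m/e)ⁿ, and the end point W = m/e otherwise. The obstacle in the
-- induction is a nonempty smallest slice: only M - c edges in the new direction are guaranteed, c
-- short of the M that would close the estimate by the first hypothesis alone. The slices below the
-- maximum make up for this: the tangent of exp together with c ≤ Nᵢ ≤ M puts Σ Nᵢ ln Nᵢ at least c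
-- (m M - N) / M below N ln M, and τ ≤ ln m makes this gain large enough.

infix  4 _≼_
infixl 6 _+ℝ_ _⊕_
infixl 7 _⊗_

-- Order and arithmetic of Cauchy reals

_+ℝ_ : ℝ → ℝ → ℝ
x +ℝ y = mkℝ (λ i → seq x i + seq y i) +-cauchy
  where
  eq : ∀ a b c d → (a - c) + (b - d) ≡ a + b - (c + d)
  eq = solve 4 (λ a b c d → (a :- c) :+ (b :- d) := a :+ b :- (c :+ d)) refl
  +-cauchy : Cauchy (λ i → seq x i + seq y i)
  +-cauchy {ε} 0<ε =
    let M , hx = cauchy x (halve 0<ε)
        N , hy = cauchy y (halve 0<ε)
    in M ℕ.⊔ N , λ i j h k → subst₂ ℚ._≤_
         (cong ∣_∣ (eq (seq x i) (seq y i) (seq x j) (seq y j))) (halves ε)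
         (ℚ.≤-trans (ℚ.∣p+q∣≤∣p∣+∣q∣ (seq x i - seq x j) (seq y i - seq y j))
           (ℚ.+-mono-≤ (hx i j (ℕ.m⊔n≤o⇒m≤o M N h) (ℕ.m⊔n≤o⇒m≤o M N k))
                       (hy i j (ℕ.m⊔n≤o⇒n≤o M N h) (ℕ.m⊔n≤o⇒n≤o M N k))))

-- Reified expressions: constructors unify argument by argument, whereas Agda
-- unfolds the operations on ℝ, and with them their Cauchy moduli.
data Term : Set where
  real    : ℝ → Term
  rat     : ℚ → Term
  _⊕_ _⊗_ : Term → Term → Term
  Exp     : Term → Term

nat : ℕ → Term
nat n = rat (fromℕ n)

⟦_⟧ : Term → ℝ
⟦ real x ⟧ = x
⟦ rat q ⟧  = fromℚ q
⟦ x ⊕ y ⟧  = ⟦ x ⟧ +ℝ ⟦ y ⟧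
⟦ x ⊗ y ⟧  = ⟦ x ⟧ *ℝ ⟦ y ⟧
⟦ Exp x ⟧  = exp ⟦ x ⟧

val : Term → ℕ → ℚ
val x = seq ⟦ x ⟧

-- A record rather than a synonym, so that both terms can be read off the type; `_≤ℝ_` itself
-- unfolds to a statement about `seq`.
record _≼_ (x y : Term) : Set where
  constructor ⟪_⟫
  field
    ≼⇒≤ : ⟦ x ⟧ ≤ℝ ⟦ y ⟧

open _≼_

≼-pointwise : ∀ {x y} → (∀ i → val x i ℚ.≤ val y i) → x ≼ y
≼-pointwise h = ⟪ (λ {ε} 0<ε → 0 , λ i _ → ℚ.≤-trans (h i) (≤-from-gap ε (ℚ.<⇒≤ 0<ε) refl)) ⟫

≼-reflexive : ∀ {x y} → (∀ i → val x i ≡ val y i) → x ≼ y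
≼-reflexive h = ≼-pointwise λ i → ℚ.≤-reflexive (h i)

≼-trans : ∀ {x y z} → x ≼ y → y ≼ z → x ≼ z
≼-trans {x} {y} {z} ⟪ h ⟫ ⟪ k ⟫ = ⟪ (λ {ε} 0<ε →
  let M , hM = h (halve 0<ε)
      N , kN = k (halve 0<ε)
  in M ℕ.⊔ N , λ i l → ℚ.≤-trans (hM i (ℕ.m⊔n≤o⇒m≤o M N l))
       (ℚ.≤-trans (ℚ.+-monoˡ-≤ (½ * ε) (kN i (ℕ.m⊔n≤o⇒n≤o M N l)))
         (ℚ.≤-reflexive (eq (val z i) ε)))) ⟫
  where
  eq : ∀ a ε → a + ½ * ε + ½ * ε ≡ a + ε
  eq = solve 2 (λ a ε → a :+ con ½ :* ε :+ con ½ :* ε := a :+ ε) refl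

≼-refl : ∀ {x} → x ≼ x
≼-refl = ≼-reflexive λ _ → refl

infixr 2 _≼⟨_⟩_
infix  3 _∎

_≼⟨_⟩_ : ∀ x {y z} → x ≼ y → y ≼ z → x ≼ z
x ≼⟨ h ⟩ k = ≼-trans h k

_∎ : ∀ x → x ≼ x
x ∎ = ≼-refl

-- The hypothesis on the terms says y′ - x′ = y - x.
≼-rearrange : ∀ {x y x′ y′} → x ≼ y → (∀ i → val x′ i + val y i ≡ val x i + val y′ i) → x′ ≼ y′
≼-rearrange {x} {y} {x′} {y′} ⟪ h ⟫ eq = ⟪ (λ {ε} 0<ε → let N , hN = h 0<ε in N , λ i N≤i →
  ≤-from-gap (val y i + ε - val x i) (gap (hN i N≤i))
    (trans (split (val x i) (val y′ i) ε) (trans (cong (λ z → z + ε - val x i) (sym (eq i)))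
      (regroup (val x i) (val y i) (val x′ i) ε)))) ⟫
  where
  split : ∀ x y′ ε → y′ + ε ≡ x + y′ + ε - x
  split = solve 3 (λ x y′ ε → y′ :+ ε := x :+ y′ :+ ε :- x) refl
  regroup : ∀ x y x′ ε → x′ + y + ε - x ≡ x′ + (y + ε - x)
  regroup = solve 4 (λ x y x′ ε → x′ :+ y :+ ε :- x := x′ :+ (y :+ ε :- x)) refl

⊕-mono : ∀ {x y z w} → x ≼ y → z ≼ w → x ⊕ z ≼ y ⊕ w
⊕-mono {x} {y} {z} {w} ⟪ h ⟫ ⟪ k ⟫ = ⟪ (λ {ε} 0<ε →
  let M , hM = h (halve 0<ε)
      N , kN = k (halve 0<ε)
  in M ℕ.⊔ N , λ i l → ℚ.≤-trans
       (ℚ.+-mono-≤ (hM i (ℕ.m⊔n≤o⇒m≤o M N l)) (kN i (ℕ.m⊔n≤o⇒n≤o M N l)))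
       (ℚ.≤-reflexive (eq (val y i) (val w i) ε))) ⟫
  where
  eq : ∀ y w ε → (y + ½ * ε) + (w + ½ * ε) ≡ y + w + ε
  eq = solve 3 (λ y w ε → (y :+ con ½ :* ε) :+ (w :+ con ½ :* ε) := y :+ w :+ ε) refl

-- Nonnegativity of every approximant, which is stronger than that of the real. The rational
-- inequalities for `expSum` can then be applied at each index.
record NonNeg (x : Term) : Set where
  constructor nonNeg
  field
    0≤val : ∀ i → 0ℚ ℚ.≤ val x i

open NonNeg

NonNeg-+ : ∀ {x y} → NonNeg x → NonNeg y → NonNeg (x ⊕ y)
NonNeg-+ (nonNeg h) (nonNeg k) = nonNeg λ i → 0≤+ (h i) (k i)

NonNeg-* : ∀ {x y} → NonNeg x → NonNeg y → NonNeg (x ⊗ y)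
NonNeg-* (nonNeg h) (nonNeg k) = nonNeg λ i → 0≤* (h i) (k i)

NonNeg-nat : ∀ n → NonNeg (nat n)
NonNeg-nat n = nonNeg λ _ → 0≤fromℕ n

⊗-monoʳ : ∀ {x y z} → NonNeg z → x ≼ y → z ⊗ x ≼ z ⊗ y
⊗-monoʳ {x} {y} {z} (nonNeg 0≤z) ⟪ h ⟫ = ⟪ (λ {ε} 0<ε →
  let b , 0≤b , M , hM = eventually-bounded {val z} (cauchy ⟦ z ⟧)
      δ , 0<δ , bδ≤ε   = shrink b 0≤b 0<ε
      N , hN           = h 0<δ
  in M ℕ.⊔ N , λ i l → ℚ.≤-trans (*-monoʳ (val z i) (0≤z i) (hN i (ℕ.m⊔n≤o⇒n≤o M N l)))
       (ℚ.≤-trans (ℚ.≤-reflexive (ℚ.*-distribˡ-+ (val z i) (val y i) δ))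
         (ℚ.+-monoʳ-≤ (val z i * val y i)
           (ℚ.≤-trans (*-monoˡ δ (ℚ.<⇒≤ 0<δ)
              (ℚ.≤-trans (p≤∣p∣ (val z i)) (hM i (ℕ.m⊔n≤o⇒m≤o M N l)))) bδ≤ε)))) ⟫

⊗-monoˡ : ∀ {x y z} → NonNeg z → x ≼ y → x ⊗ z ≼ y ⊗ z
⊗-monoˡ {x} {y} {z} 0≤z h = ≼-rearrange (⊗-monoʳ 0≤z h) λ i → eq (val x i) (val y i) (val z i)
  where
  eq : ∀ x y z → x * z + z * y ≡ z * x + y * z
  eq = solve 3 (λ x y z → x :* z :+ z :* y := z :* x :+ y :* z) refl

-- With factors that are at least 1 the error `ε` need not be rescaled: if y ≤ x, then x - y ≤ z (x
-- - y) ≤ ε.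
⊗-cancelˡ : ∀ {x y z} → (∀ i → 1ℚ ℚ.≤ val z i) → z ⊗ x ≼ z ⊗ y → x ≼ y
⊗-cancelˡ {x} {y} {z} 1≤z ⟪ h ⟫ = ⟪ (λ {ε} 0<ε → let N , hN = h 0<ε in N , λ i N≤i →
  bound (1≤z i) (ℚ.<⇒≤ 0<ε) (hN i N≤i) (ℚ.≤-total (val x i) (val y i))) ⟫
  where
  eq₁ : ∀ x y ε → y + ε ≡ x + (y - x + ε)
  eq₁ = solve 3 (λ x y ε → y :+ ε := x :+ (y :- x :+ ε)) refl
  eq₂ : ∀ x y z ε → y + ε ≡ x + ((z * y + ε - z * x) + (z - 1ℚ) * (x - y))
  eq₂ = solve 4 (λ x y z ε → y :+ ε := x :+ ((z :* y :+ ε :- z :* x) :+ (z :- con 1ℚ) :* (x :- y))) refl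
  bound : ∀ {x y z ε} → 1ℚ ℚ.≤ z → 0ℚ ℚ.≤ ε → z * x ℚ.≤ z * y + ε → x ℚ.≤ y ⊎ y ℚ.≤ x → x ℚ.≤ y + ε
  bound {x} {y} {z} {ε} 1≤z 0≤ε h (inj₁ x≤y) = ≤-from-gap _ (0≤+ (gap x≤y) 0≤ε) (eq₁ x y ε)
  bound {x} {y} {z} {ε} 1≤z 0≤ε h (inj₂ y≤x) =
    ≤-from-gap _ (0≤+ (gap h) (0≤* (gap 1≤z) (gap y≤x))) (eq₂ x y z ε)

fromℕ-+ : ∀ a b → fromℕ (a ℕ.+ b) ≡ fromℕ a + fromℕ b
fromℕ-+ zero    b = sym (ℚ.+-identityˡ (fromℕ b))
fromℕ-+ (suc a) b = trans (fromℕ-suc (a ℕ.+ b)) (trans (cong (λ h → 1ℚ + h) (fromℕ-+ a b))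
  (trans (sym (ℚ.+-assoc 1ℚ (fromℕ a) (fromℕ b))) (cong (_+ fromℕ b) (sym (fromℕ-suc a)))))

1≤fromℕ : ∀ {n} → 1 ≤ n → 1ℚ ℚ.≤ fromℕ n
1≤fromℕ = fromℕ-mono

-- The exponential series

partialSum : (ℕ → ℚ) → ℕ → ℚ
partialSum s zero    = s 0
partialSum s (suc n) = partialSum s n + s (suc n)

-- The Cauchy product Σ_{i ≤ n} s i * t (n - i).
conv : (ℕ → ℚ) → (ℕ → ℚ) → ℕ → ℚ
conv s t zero    = s 0 * t 0
conv s t (suc n) = s 0 * t (suc n) + conv (s ∘ suc) t n

partialSum-suc : ∀ s n → partialSum s (suc n) ≡ s 0 + partialSum (s ∘ suc) n
partialSum-suc s zero    = refl
partialSum-suc s (suc n) = trans (cong (_+ s (suc (suc n))) (partialSum-suc s n))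
  (ℚ.+-assoc (s 0) (partialSum (s ∘ suc) n) (s (suc (suc n))))

partialSum-mono : ∀ {s} → (∀ i → 0ℚ ℚ.≤ s i) → ∀ {m n} → m ≤ n → partialSum s m ℚ.≤ partialSum s n
partialSum-mono {s} 0≤s {m} m≤n = go (ℕ.≤⇒≤′ m≤n)
  where
  go : ∀ {n} → m ℕ.≤′ n → partialSum s m ℚ.≤ partialSum s n
  go ℕ.≤′-refl             = ℚ.≤-refl
  go (ℕ.≤′-step {n = n} h) = ℚ.≤-trans (go h) (≤-from-gap (s (suc n)) (0≤s (suc n)) refl)

0≤partialSum : ∀ {s} → (∀ i → 0ℚ ℚ.≤ s i) → ∀ n → 0ℚ ℚ.≤ partialSum s n
0≤partialSum 0≤s zero    = 0≤s 0
0≤partialSum 0≤s (suc n) = 0≤+ (0≤partialSum 0≤s n) (0≤s (suc n))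

partialSum-conv : ∀ s t n → partialSum (conv s t) n ≡ conv s (partialSum t) n
partialSum-conv s t zero    = refl
partialSum-conv s t (suc n) = trans (cong (_+ conv s t (suc n)) (partialSum-conv s t n)) (conv-step s n)
  where
  base : ∀ a b t₀ t₁ → a * t₀ + (a * t₁ + b * t₀) ≡ a * (t₀ + t₁) + b * t₀
  base = solve 4 (λ a b t₀ t₁ → a :* t₀ :+ (a :* t₁ :+ b :* t₀) := a :* (t₀ :+ t₁) :+ b :* t₀) refl
  step : ∀ a p t c d → a * p + c + (a * t + d) ≡ a * (p + t) + (c + d)
  step = solve 5 (λ a p t c d → a :* p :+ c :+ (a :* t :+ d) := a :* (p :+ t) :+ (c :+ d)) refl
  conv-step : ∀ s n → conv s (partialSum t) n + conv s t (suc n) ≡ conv s (partialSum t) (suc n)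
  conv-step s zero    = base (s 0) (s 1) (t 0) (t 1)
  conv-step s (suc n) = trans
    (step (s 0) (partialSum t (suc n)) (t (suc (suc n))) (conv (s ∘ suc) (partialSum t) n) (conv (s ∘ suc) t (suc n)))
    (cong (λ c → s 0 * partialSum t (suc (suc n)) + c) (conv-step (s ∘ suc) n))

-- `conv s (partialSum t) n` sums s i * t j over the triangle i + j ≤ n, which lies inside the
-- square i, j ≤ n.
conv≤partialSum* : ∀ {s t} → (∀ i → 0ℚ ℚ.≤ s i) → (∀ i → 0ℚ ℚ.≤ t i) → ∀ n →
                   conv s (partialSum t) n ℚ.≤ partialSum s n * partialSum t n
conv≤partialSum* 0≤s 0≤t zero = ℚ.≤-refl
conv≤partialSum* {s} {t} 0≤s 0≤t (suc n) = ℚ.≤-trans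
  (ℚ.+-monoʳ-≤ (s 0 * partialSum t (suc n)) (ℚ.≤-trans (conv≤partialSum* (0≤s ∘ suc) 0≤t n)
    (*-monoʳ (partialSum (s ∘ suc) n) (0≤partialSum (0≤s ∘ suc) n) (partialSum-mono {t} 0≤t (ℕ.n≤1+n n)))))
  (ℚ.≤-reflexive (trans (sym (ℚ.*-distribʳ-+ (partialSum t (suc n)) (s 0) (partialSum (s ∘ suc) n)))
    (cong (_* partialSum t (suc n)) (sym (partialSum-suc s n)))))

-- Conversely, the rectangle i ≤ m, j ≤ n lies inside the triangle i + j ≤ m + n.
partialSum*≤conv : ∀ {s t} → (∀ i → 0ℚ ℚ.≤ s i) → (∀ i → 0ℚ ℚ.≤ t i) → ∀ m n →
                   partialSum s m * partialSum t n ℚ.≤ conv s (partialSum t) (m ℕ.+ n)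
partialSum*≤conv 0≤s 0≤t zero zero = ℚ.≤-refl
partialSum*≤conv {s} {t} 0≤s 0≤t zero (suc n) =
  ≤-from-gap (conv (s ∘ suc) (partialSum t) n) (0≤conv (0≤s ∘ suc) n) refl
  where
  0≤conv : ∀ {s} → (∀ i → 0ℚ ℚ.≤ s i) → ∀ n → 0ℚ ℚ.≤ conv s (partialSum t) n
  0≤conv 0≤s zero    = 0≤* (0≤s 0) (0≤t 0)
  0≤conv 0≤s (suc n) = 0≤+ (0≤* (0≤s 0) (0≤partialSum 0≤t (suc n))) (0≤conv (0≤s ∘ suc) n)
partialSum*≤conv {s} {t} 0≤s 0≤t (suc m) n = ℚ.≤-trans
  (ℚ.≤-reflexive (trans (cong (_* partialSum t n) (partialSum-suc s m))
    (ℚ.*-distribʳ-+ (partialSum t n) (s 0) (partialSum (s ∘ suc) m))))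
  (ℚ.+-mono-≤ (*-monoʳ (s 0) (0≤s 0) (partialSum-mono {t} 0≤t (ℕ.≤-trans (ℕ.m≤n+m n m) (ℕ.n≤1+n _))))
    (partialSum*≤conv (0≤s ∘ suc) 0≤t m n))

conv-scaleˡ : ∀ p s t n → conv (λ i → p * s i) t n ≡ p * conv s t n
conv-scaleˡ p s t zero    = ℚ.*-assoc p (s 0) (t 0)
conv-scaleˡ p s t (suc n) = trans (cong (λ c → p * s 0 * t (suc n) + c) (conv-scaleˡ p (s ∘ suc) t n))
  (eq p (s 0) (t (suc n)) (conv (s ∘ suc) t n))
  where
  eq : ∀ p a b c → p * a * b + p * c ≡ p * (a * b + c)
  eq = solve 4 (λ p a b c → p :* a :* b :+ p :* c := p :* (a :* b :+ c)) refl

conv-congˡ : ∀ {s s′} → (∀ i → s i ≡ s′ i) → ∀ t n → conv s t n ≡ conv s′ t n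
conv-congˡ h t zero    = cong (_* t 0) (h 0)
conv-congˡ h t (suc n) = cong₂ (λ a c → a * t (suc n) + c) (h 0) (conv-congˡ (h ∘ suc) t n)

weighted : (ℕ → ℚ) → ℕ → ℚ
weighted s i = fromℕ i * s i

conv-+ˡ : ∀ s s′ t n → conv (λ i → s i + s′ i) t n ≡ conv s t n + conv s′ t n
conv-+ˡ s s′ t zero    = ℚ.*-distribʳ-+ (t 0) (s 0) (s′ 0)
conv-+ˡ s s′ t (suc n) = trans (cong (λ c → (s 0 + s′ 0) * t (suc n) + c) (conv-+ˡ (s ∘ suc) (s′ ∘ suc) t n))
  (eq (s 0) (s′ 0) (t (suc n)) (conv (s ∘ suc) t n) (conv (s′ ∘ suc) t n))
  where
  eq : ∀ a b t c d → (a + b) * t + (c + d) ≡ a * t + c + (b * t + d)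
  eq = solve 5 (λ a b t c d → (a :+ b) :* t :+ (c :+ d) := a :* t :+ c :+ (b :* t :+ d)) refl

-- The product rule for the derivation x d/dx on power series.
weighted-conv : ∀ s t n → weighted (conv s t) n ≡ conv (weighted s) t n + conv s (weighted t) n
weighted-conv s t zero    = eq (s 0) (t 0)
  where
  eq : ∀ a b → 0ℚ * (a * b) ≡ 0ℚ * a * b + a * (0ℚ * b)
  eq = solve 2 (λ a b → con 0ℚ :* (a :* b) := con 0ℚ :* a :* b :+ a :* (con 0ℚ :* b)) refl
weighted-conv s t (suc n) = trans (cong (_* conv s t (suc n)) (fromℕ-suc n))
  (trans (eq₁ (fromℕ n) (s 0) (t (suc n)) (conv s′ t n))
  (trans (cong (λ h → s 0 * ((1ℚ + fromℕ n) * t (suc n)) + h + conv s′ t n) (weighted-conv s′ t n))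
  (trans (eq₂ (s 0) ((1ℚ + fromℕ n) * t (suc n)) (conv (weighted s′) t n) (conv s′ (weighted t) n) (conv s′ t n) (t (suc n)))
    (cong₂ (λ a b → 0ℚ * s 0 * t (suc n) + a + (s 0 * (b * t (suc n)) + conv s′ (weighted t) n))
      (sym shift) (sym (fromℕ-suc n))))))
  where
  s′ : ℕ → ℚ
  s′ = s ∘ suc
  shift : conv (λ i → weighted s (suc i)) t n ≡ conv (weighted s′) t n + conv s′ t n
  shift = trans (conv-congˡ (λ i → trans (cong (_* s′ i) (fromℕ-suc i)) (eq₃ (fromℕ i) (s′ i))) t n)
    (conv-+ˡ (weighted s′) s′ t n)
    where
    eq₃ : ∀ n a → (1ℚ + n) * a ≡ n * a + a
    eq₃ = solve 2 (λ n a → (con 1ℚ :+ n) :* a := n :* a :+ a) refl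
  eq₁ : ∀ n a b c → (1ℚ + n) * (a * b + c) ≡ a * ((1ℚ + n) * b) + n * c + c
  eq₁ = solve 4 (λ n a b c → (con 1ℚ :+ n) :* (a :* b :+ c) := a :* ((con 1ℚ :+ n) :* b) :+ n :* c :+ c) refl
  eq₂ : ∀ a b c d f t → a * b + (c + d) + f ≡ 0ℚ * a * t + (c + f) + (a * b + d)
  eq₂ = solve 6 (λ a b c d f t → a :* b :+ (c :+ d) :+ f := con 0ℚ :* a :* t :+ (c :+ f) :+ (a :* b :+ d)) refl

-- As a power series in X, `u` is q X t, so the product with `s` is q X times that of `s` and `t`.
conv-0∷ʳ : ∀ q s t u → u 0 ≡ 0ℚ → (∀ i → u (suc i) ≡ q * t i) → ∀ n → conv s u (suc n) ≡ q * conv s t n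
conv-0∷ʳ q s t u u₀ uₛ zero = trans (cong₂ (λ a b → s 0 * a + s 1 * b) (uₛ 0) u₀) (eq q (s 0) (s 1) (t 0))
  where
  eq : ∀ q a b t → a * (q * t) + b * 0ℚ ≡ q * (a * t)
  eq = solve 4 (λ q a b t → a :* (q :* t) :+ b :* con 0ℚ := q :* (a :* t)) refl
conv-0∷ʳ q s t u u₀ uₛ (suc n) = trans
  (cong₂ (λ a b → s 0 * a + b) (uₛ (suc n)) (conv-0∷ʳ q (s ∘ suc) t u u₀ uₛ n))
  (eq q (s 0) (t (suc n)) (conv (s ∘ suc) t n))
  where
  eq : ∀ q a t c → a * (q * t) + q * c ≡ q * (a * t + c)
  eq = solve 4 (λ q a t c → a :* (q :* t) :+ q :* c := q :* (a :* t :+ c)) refl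

-- The binomial theorem divided by n!, without binomial coefficients: by the product rule both sides
-- satisfy the recursion (n + 1) a (n + 1) = (p + q) a n of the exponential series.
conv-expTerm : ∀ p q n → conv (λ k → expTerm k p) (λ k → expTerm k q) n ≡ expTerm n (p + q)
conv-expTerm p q zero    = refl
conv-expTerm p q (suc n) = ℚ.≤-antisym (fromℕ-cancel n (ℚ.≤-reflexive eq)) (fromℕ-cancel n (ℚ.≤-reflexive (sym eq)))
  where
  s t : ℕ → ℚ
  s k = expTerm k p
  t k = expTerm k q
  0* : ∀ a b c → 0ℚ * a * b + c ≡ c
  0* = solve 3 (λ a b c → con 0ℚ :* a :* b :+ c := c) refl
  left : conv (weighted s) t (suc n) ≡ p * conv s t n
  left = trans (0* (s 0) (t (suc n)) _) (trans (conv-congˡ (λ i → expTerm-suc i p) t n) (conv-scaleˡ p s t n))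
  right : conv s (weighted t) (suc n) ≡ q * conv s t n
  right = conv-0∷ʳ q s t (weighted t) (ℚ.*-zeroˡ (t 0)) (λ i → expTerm-suc i q) n
  eq : fromℕ (suc n) * conv s t (suc n) ≡ fromℕ (suc n) * expTerm (suc n) (p + q)
  eq = trans (weighted-conv s t (suc n)) (trans (cong₂ _+_ left right)
    (trans (sym (ℚ.*-distribʳ-+ (conv s t n) p q))
    (trans (cong ((p + q) *_) (conv-expTerm p q n)) (sym (expTerm-suc n (p + q))))))

expSum≡partialSum : ∀ x n → expSum n x ≡ partialSum (λ k → expTerm k x) n
expSum≡partialSum x zero    = refl
expSum≡partialSum x (suc n) = cong (_+ expTerm (suc n) x) (expSum≡partialSum x n)

expSum-conv : ∀ p q n → expSum n (p + q) ≡ conv (λ k → expTerm k p) (partialSum (λ k → expTerm k q)) n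
expSum-conv p q n = trans (go n) (partialSum-conv (λ k → expTerm k p) (λ k → expTerm k q) n)
  where
  go : ∀ n → expSum n (p + q) ≡ partialSum (conv (λ k → expTerm k p) (λ k → expTerm k q)) n
  go zero    = sym (conv-expTerm p q 0)
  go (suc n) = cong₂ _+_ (go n) (sym (conv-expTerm p q (suc n)))

expSum-+≤ : ∀ {p q} → 0ℚ ℚ.≤ p → 0ℚ ℚ.≤ q → ∀ n → expSum n (p + q) ℚ.≤ expSum n p * expSum n q
expSum-+≤ {p} {q} 0≤p 0≤q n = subst₂ ℚ._≤_ (sym (expSum-conv p q n))
  (sym (cong₂ _*_ (expSum≡partialSum p n) (expSum≡partialSum q n)))
  (conv≤partialSum* {λ k → expTerm k p} {λ k → expTerm k q} (λ k → 0≤expTerm k 0≤p) (λ k → 0≤expTerm k 0≤q) n)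

expSum-*≤ : ∀ {p q} → 0ℚ ℚ.≤ p → 0ℚ ℚ.≤ q → ∀ n → expSum n p * expSum n q ℚ.≤ expSum (n ℕ.+ n) (p + q)
expSum-*≤ {p} {q} 0≤p 0≤q n = subst₂ ℚ._≤_
  (sym (cong₂ _*_ (expSum≡partialSum p n) (expSum≡partialSum q n))) (sym (expSum-conv p q (n ℕ.+ n)))
  (partialSum*≤conv {λ k → expTerm k p} {λ k → expTerm k q} (λ k → 0≤expTerm k 0≤p) (λ k → 0≤expTerm k 0≤q) n n)

-- `expSum n` is the derivative of `expSum (suc n)`, a polynomial that is convex on the nonnegative
-- half-line because each of its terms is. The proof adds up the tangent inequalities of the terms.
expSum-tangent : ∀ {p q} → 0ℚ ℚ.≤ p → 0ℚ ℚ.≤ q → ∀ n →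
                 expSum (suc n) p + expSum n p * (q - p) ℚ.≤ expSum (suc n) q
expSum-tangent {p} {q} 0≤p 0≤q zero = ℚ.≤-reflexive (eq p q)
  where
  eq : ∀ p q → 1ℚ + p * 1ℚ * 1ℚ + 1ℚ * (q - p) ≡ 1ℚ + q * 1ℚ * 1ℚ
  eq = solve 2 (λ p q → con 1ℚ :+ p :* con 1ℚ :* con 1ℚ :+ con 1ℚ :* (q :- p) := con 1ℚ :+ q :* con 1ℚ :* con 1ℚ) refl
expSum-tangent {p} {q} 0≤p 0≤q (suc n) = ℚ.≤-trans
  (ℚ.≤-reflexive (eq (expSum (suc n) p) (expTerm (suc (suc n)) p) (expSum n p) (expTerm (suc n) p) (q - p)))
  (ℚ.+-mono-≤ (expSum-tangent 0≤p 0≤q n) (term (suc n)))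
  where
  eq : ∀ s t u v d → s + t + (u + v) * d ≡ s + u * d + (t + v * d)
  eq = solve 5 (λ s t u v d → s :+ t :+ (u :+ v) :* d := s :+ u :* d :+ (t :+ v :* d)) refl
  square : ∀ p q → 0ℚ ℚ.≤ (q - p) * (q - p)
  square p q with ℚ.≤-total p q
  ... | inj₁ p≤q = 0≤* (gap p≤q) (gap p≤q)
  ... | inj₂ q≤p = subst (0ℚ ℚ.≤_) (flip p q) (0≤* (gap q≤p) (gap q≤p))
    where
    flip : ∀ p q → (p - q) * (p - q) ≡ (q - p) * (q - p)
    flip = solve 2 (λ p q → (p :- q) :* (p :- q) := (q :- p) :* (q :- p)) refl
  term : ∀ n → expTerm (suc n) p + expTerm n p * (q - p) ℚ.≤ expTerm (suc n) q
  term zero = ℚ.≤-reflexive (eq₀ p q)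
    where
    eq₀ : ∀ p q → p * 1ℚ * 1ℚ + 1ℚ * (q - p) ≡ q * 1ℚ * 1ℚ
    eq₀ = solve 2 (λ p q → p :* con 1ℚ :* con 1ℚ :+ con 1ℚ :* (q :- p) := q :* con 1ℚ :* con 1ℚ) refl
  -- Multiplied by n + 2, the gap is (q - p)² * expTerm n p plus q times the gap one step before.
  term (suc n) = fromℕ-cancel (suc n) (≤-from-gap
    (q * (expTerm (suc n) q - (expTerm (suc n) p + expTerm n p * (q - p))) + (q - p) * (q - p) * expTerm n p)
    (0≤+ (0≤* 0≤q (gap (term n))) (0≤* (square p q) (0≤expTerm n 0≤p)))
    (trans (expTerm-suc (suc n) q) (sym (trans
      (cong (_+ r) (trans (ℚ.*-distribˡ-+ k t₂ (t₁ * (q - p))) (cong₂ _+_ (expTerm-suc (suc n) p)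
        (trans (cong (_* (t₁ * (q - p))) (fromℕ-suc (suc n)))
          (trans (eq₂ (fromℕ (suc n)) t₁ (q - p)) (cong (λ z → t₁ * (q - p) + z * (q - p)) (expTerm-suc n p)))))))
      (eq₁ p q t₁ (expTerm n p) (expTerm (suc n) q))))))
    where
    k t₁ t₂ r : ℚ
    k  = fromℕ (suc (suc n))
    t₁ = expTerm (suc n) p
    t₂ = expTerm (suc (suc n)) p
    r  = q * (expTerm (suc n) q - (expTerm (suc n) p + expTerm n p * (q - p))) + (q - p) * (q - p) * expTerm n p
    eq₁ : ∀ p q t₁ t₀ u → p * t₁ + (t₁ * (q - p) + p * t₀ * (q - p)) +
            (q * (u - (t₁ + t₀ * (q - p))) + (q - p) * (q - p) * t₀) ≡ q * u
    eq₁ = solve 5 (λ p q t₁ t₀ u → p :* t₁ :+ (t₁ :* (q :- p) :+ p :* t₀ :* (q :- p)) :+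
            (q :* (u :- (t₁ :+ t₀ :* (q :- p))) :+ (q :- p) :* (q :- p) :* t₀) := q :* u) refl
    eq₂ : ∀ n t d → (1ℚ + n) * (t * d) ≡ t * d + n * t * d
    eq₂ = solve 3 (λ n t d → (con 1ℚ :+ n) :* (t :* d) := t :* d :+ n :* t :* d) refl

-- Exponential and logarithm of reals

NonNeg-1 : NonNeg (rat 1ℚ)
NonNeg-1 = nonNeg λ _ → 0≤1

NonNeg-exp : ∀ {x} → NonNeg x → NonNeg (Exp x)
NonNeg-exp (nonNeg h) = nonNeg λ i → 0≤expSum i (h i)

1≤exp : ∀ {x} → NonNeg x → ∀ i → 1ℚ ℚ.≤ val (Exp x) i
1≤exp (nonNeg h) i = expSum-mono {0} {i} (h i) ℕ.z≤n

exp-cong : ∀ {x y} → (∀ i → val x i ≡ val y i) → Exp x ≼ Exp y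
exp-cong h = ≼-reflexive λ i → cong (expSum i) (h i)

exp-+≤ : ∀ {x y} → NonNeg x → NonNeg y → Exp (x ⊕ y) ≼ Exp x ⊗ Exp y
exp-+≤ (nonNeg h) (nonNeg k) = ≼-pointwise λ i → expSum-+≤ (h i) (k i) i

-- Unlike its converse this is not an inequality index by index: the triangle that contains the
-- square has twice its size, so the sum up to i + i must be brought back to i. The tail of the
-- series after i is at most `ε`.
exp-*≤ : ∀ {x y} → NonNeg x → NonNeg y → Exp x ⊗ Exp y ≼ Exp (x ⊕ y)
exp-*≤ {x} {y} (nonNeg h) (nonNeg k) = ⟪ (λ {ε} 0<ε →
  let b , 0≤b , N , hN = eventually-bounded {val (x ⊕ y)} (cauchy ⟦ x ⊕ y ⟧)
      open Tail 0≤b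
      M , K≤M , t≤ = t-small 0<ε
  in N ℕ.⊔ M , λ i l →
    let N≤i = ℕ.m⊔n≤o⇒m≤o N M l
        M≤i = ℕ.m⊔n≤o⇒n≤o N M l
        s   = val x i + val y i
    in ℚ.≤-trans (expSum-*≤ (h i) (k i) i) (ℚ.≤-trans
         (ℚ.≤-reflexive (split (expSum (i ℕ.+ i) s) (expSum i s)))
         (ℚ.+-monoʳ-≤ (expSum i s) (ℚ.≤-trans (p≤∣p∣ (expSum (i ℕ.+ i) s - expSum i s))
           (ℚ.≤-trans (∣tail∣ (hN i N≤i) (ℕ.≤-trans K≤M M≤i) (ℕ.m≤m+n i i))
             (ℚ.≤-trans (t-anti K≤M M≤i) t≤)))))) ⟫
  where
  split : ∀ a b → a ≡ b + (a - b)
  split = solve 2 (λ a b → a := b :+ (a :- b)) refl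

-- The tangent inequality Exp y ≥ Exp x * (1 + y - x), without subtraction.
exp-tangent : ∀ {x y} → NonNeg x → NonNeg y → Exp x ⊗ (rat 1ℚ ⊕ y) ≼ Exp y ⊕ Exp x ⊗ x
exp-tangent {x} {y} (nonNeg h) (nonNeg k) = ⟪ (λ {ε} 0<ε →
  let b , 0≤b , N , hN = eventually-bounded {val y} (cauchy ⟦ y ⟧)
      open Tail 0≤b
      M , K≤M , t≤ = t-small 0<ε
  in N ℕ.⊔ M , λ i l →
    let N≤i = ℕ.m⊔n≤o⇒m≤o N M l
        M≤i = ℕ.m⊔n≤o⇒n≤o N M l
        K≤i = ℕ.≤-trans K≤M M≤i
        p   = val x i
        q   = val y i
        t≤ε = ℚ.≤-trans (expTerm-mono (suc i) (k i) (ℚ.≤-trans (p≤∣p∣ q) (hN i N≤i)))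
                (ℚ.≤-trans (t-step K≤i) (ℚ.≤-trans (t-anti K≤M M≤i) t≤))
    in ≤-from-gap _
         (0≤+ (0≤+ (0≤expTerm (suc i) (h i)) (gap (expSum-tangent (h i) (k i) i))) (gap t≤ε))
         (eq (expSum i p) (expTerm (suc i) p) (expSum i q) (expTerm (suc i) q) p q ε)) ⟫
  where
  eq : ∀ f t g u p q ε → g + f * p + ε ≡ f * (1ℚ + q) + (t + (g + u - (f + t + f * (q - p))) + (ε - u))
  eq = solve 7 (λ f t g u p q ε → g :+ f :* p :+ ε :=
    f :* (con 1ℚ :+ q) :+ (t :+ (g :+ u :- (f :+ t :+ f :* (q :- p))) :+ (ε :- u))) refl

-- The entry point for logarithms: `α` replaces Exp x on both sides and so has to equal it, while
-- `β` replaces Exp y on the larger side only and may be any upper bound.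
exp-tangent′ : ∀ {x y α β} → NonNeg x → NonNeg y → α ≼ Exp x → Exp x ≼ α → Exp y ≼ β →
               α ⊗ (rat 1ℚ ⊕ y) ≼ β ⊕ α ⊗ x
exp-tangent′ {x} {y} {α} {β} 0≤x 0≤y α≤ ≤α ≤β =
  α ⊗ (rat 1ℚ ⊕ y)       ≼⟨ ⊗-monoˡ (NonNeg-+ NonNeg-1 0≤y) α≤ ⟩
  Exp x ⊗ (rat 1ℚ ⊕ y)   ≼⟨ exp-tangent 0≤x 0≤y ⟩
  Exp y ⊕ Exp x ⊗ x  ≼⟨ ⊕-mono ≤β (⊗-monoˡ 0≤x ≤α) ⟩
  β ⊕ α ⊗ x          ∎

-- The tangent at `y` gives Exp y * (1 + x - y) ≤ Exp x ≤ Exp y, and the factor Exp y ≥ 1 cancels.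
exp-cancel-≼ : ∀ {x y} → NonNeg x → NonNeg y → Exp x ≼ Exp y → x ≼ y
exp-cancel-≼ {x} {y} 0≤x 0≤y h = ⊗-cancelˡ {z = Exp y} (1≤exp 0≤y)
  (≼-rearrange (exp-tangent′ 0≤y 0≤x ≼-refl ≼-refl h) λ i → eq (val x i) (val y i) (val (Exp y) i))
  where
  eq : ∀ x y f → f * x + (f + f * y) ≡ f * (1ℚ + x) + f * y
  eq = solve 3 (λ x y f → f :* x :+ (f :+ f :* y) := f :* (con 1ℚ :+ x) :+ f :* y) refl

NonNeg-log : ∀ {x} → 1ℚ ℚ.≤ x → NonNeg (real (log x))
NonNeg-log {x} 1≤x with 1ℚ ≤? x | 0ℚ <? x
... | yes 1≤x′ | _ = nonNeg λ i → Log.Invariant.0≤l (Log.invariant x 1≤x′ i)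
... | no  1≰x  | _ = contradiction 1≤x 1≰x

exp-log≼ : ∀ {x} → 1ℚ ℚ.≤ x → Exp (real (log x)) ≼ rat x
exp-log≼ 1≤x = ⟪ proj₁ (exp-log 1≤x) ⟫

≼exp-log : ∀ {x} → 1ℚ ℚ.≤ x → rat x ≼ Exp (real (log x))
≼exp-log 1≤x = ⟪ proj₂ (exp-log 1≤x) ⟫

-- Slicing the grid along its first coordinate

sumOver : ∀ {X : Set} → List X → (X → ℕ) → ℕ
sumOver []       f = 0
sumOver (x ∷ xs) f = f x ℕ.+ sumOver xs f

module _ {X : Set} where

  sumOver-mono : ∀ (xs : List X) {f g} → (∀ x → f x ≤ g x) → sumOver xs f ≤ sumOver xs g
  sumOver-mono []       h = ℕ.≤-refl
  sumOver-mono (x ∷ xs) h = ℕ.+-mono-≤ (h x) (sumOver-mono xs h)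

  sumOver-cong : ∀ (xs : List X) {f g} → (∀ x → f x ≡ g x) → sumOver xs f ≡ sumOver xs g
  sumOver-cong []       h = refl
  sumOver-cong (x ∷ xs) h = cong₂ ℕ._+_ (h x) (sumOver-cong xs h)

  sumOver-+ : ∀ (xs : List X) f g → sumOver xs (λ x → f x ℕ.+ g x) ≡ sumOver xs f ℕ.+ sumOver xs g
  sumOver-+ []       f g = refl
  sumOver-+ (x ∷ xs) f g = trans (cong (λ s → f x ℕ.+ g x ℕ.+ s) (sumOver-+ xs f g))
    (eq (f x) (g x) (sumOver xs f) (sumOver xs g))
    where
    eq : ∀ a b c d → a ℕ.+ b ℕ.+ (c ℕ.+ d) ≡ a ℕ.+ c ℕ.+ (b ℕ.+ d)
    eq = solve-∀

  sumOver-0 : ∀ (xs : List X) → sumOver xs (λ _ → 0) ≡ 0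
  sumOver-0 []       = refl
  sumOver-0 (x ∷ xs) = sumOver-0 xs

  sumOver-∈ : ∀ {xs : List X} {x} f → x ∈ xs → f x ≤ sumOver xs f
  sumOver-∈ f (here refl) = ℕ.m≤m+n _ _
  sumOver-∈ f (there x∈)  = ℕ.≤-trans (sumOver-∈ f x∈) (ℕ.m≤n+m _ _)

  sumOver-++ : ∀ (xs ys : List X) f → sumOver (xs ++ ys) f ≡ sumOver xs f ℕ.+ sumOver ys f
  sumOver-++ []       ys f = refl
  sumOver-++ (x ∷ xs) ys f = trans (cong (f x ℕ.+_) (sumOver-++ xs ys f))
    (sym (ℕ.+-assoc (f x) (sumOver xs f) (sumOver ys f)))

module _ {X Y : Set} where

  sumOver-map : ∀ (g : X → Y) xs f → sumOver (map g xs) f ≡ sumOver xs (f ∘ g)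
  sumOver-map g []       f = refl
  sumOver-map g (x ∷ xs) f = cong (f (g x) ℕ.+_) (sumOver-map g xs f)

  sumOver-swap : ∀ (xs : List X) (ys : List Y) (f : X → Y → ℕ) →
                 sumOver xs (λ x → sumOver ys (f x)) ≡ sumOver ys (λ y → sumOver xs (λ x → f x y))
  sumOver-swap []       ys f = sym (sumOver-0 ys)
  sumOver-swap (x ∷ xs) ys f = trans (cong (sumOver ys (f x) ℕ.+_) (sumOver-swap xs ys f))
    (sym (sumOver-+ ys (f x) (λ y → sumOver xs (λ x → f x y))))

sumOver-cartesianProductWith : ∀ {X Y Z : Set} (g : X → Y → Z) xs ys f →
  sumOver (cartesianProductWith g xs ys) f ≡ sumOver xs (λ x → sumOver ys (λ y → f (g x y)))
sumOver-cartesianProductWith g []       ys f = refl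
sumOver-cartesianProductWith g (x ∷ xs) ys f = trans (sumOver-++ (map (g x) ys) _ f)
  (cong₂ ℕ._+_ (sumOver-map (g x) ys f) (sumOver-cartesianProductWith g xs ys f))

sumOver-allFin-suc : ∀ k f → sumOver (allFin (suc k)) f ≡ f zero ℕ.+ sumOver (allFin k) (f ∘ suc)
sumOver-allFin-suc k f = cong (f zero ℕ.+_)
  (trans (cong (λ xs → sumOver xs f) (sym (List.map-tabulate id suc))) (sumOver-map suc (allFin k) f))

[_] : Bool → ℕ
[ true  ] = 1
[ false ] = 0

[]-mono : ∀ {a b} → (T a → T b) → [ a ] ≤ [ b ]
[]-mono {false}         h = ℕ.z≤n
[]-mono {true}  {true}  h = ℕ.≤-refl
[]-mono {true}  {false} h = contradiction (h _) λ ()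

length-filterᵇ : ∀ {X : Set} (p : X → Bool) xs → length (filterᵇ p xs) ≡ sumOver xs ([_] ∘ p)
length-filterᵇ p [] = refl
length-filterᵇ p (x ∷ xs) with p x
... | true  = cong suc (length-filterᵇ p xs)
... | false = length-filterᵇ p xs

neighbour : ∀ {k} → Fin k → Σ (Fin k) λ i → Graph.Adj (Path (suc k)) zero (suc i)
neighbour {suc k} _ = zero , inj₁ refl

-- Walking along the path from `p` to `q`, `f` drops at each edge by at most the corresponding entry
-- of `b`. The walk uses distinct off-diagonal entries, so the diagonal is still free to pay for
-- `d`. The induction removes the first vertex.
path-variation : ∀ k {f d : Fin k → ℕ} {b : Fin k → Fin k → ℕ} → (∀ i → d i ≤ b i i) →
  (∀ i j → Graph.Adj (Path k) i j → f i ≤ f j ℕ.+ b i j) → ∀ p q →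
  sumOver (allFin k) d ℕ.+ f p ≤ f q ℕ.+ sumOver (allFin k) (λ i → sumOver (allFin k) (b i))
path-variation (suc k) {f} {d} {b} d≤b step p q =
  subst₂ (λ x y → x ℕ.+ f p ≤ f q ℕ.+ y) (sym (sumOver-allFin-suc k d)) (sym total) (go p q)
  where
  D R C S : ℕ
  D = sumOver (allFin k) (d ∘ suc)
  R = sumOver (allFin k) (λ j → b zero (suc j))
  C = sumOver (allFin k) (λ i → b (suc i) zero)
  S = sumOver (allFin k) (λ i → sumOver (allFin k) (λ j → b (suc i) (suc j)))
  total : sumOver (allFin (suc k)) (λ i → sumOver (allFin (suc k)) (b i)) ≡ b zero zero ℕ.+ R ℕ.+ (C ℕ.+ S)
  total = trans (sumOver-allFin-suc k (λ i → sumOver (allFin (suc k)) (b i))) (cong₂ ℕ._+_ (sumOver-allFin-suc k (b zero))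
    (trans (sumOver-cong (allFin k) λ i → sumOver-allFin-suc k (b (suc i))) 
      (sumOver-+ (allFin k) (λ i → b (suc i) zero) (λ i → sumOver (allFin k) (λ j → b (suc i) (suc j))))))
  D≤S : D ≤ S
  D≤S = sumOver-mono (allFin k) λ i → ℕ.≤-trans (d≤b (suc i)) (sumOver-∈ (λ j → b (suc i) (suc j)) (∈-allFin i))
  rec : ∀ p q → D ℕ.+ f (suc p) ≤ f (suc q) ℕ.+ S
  rec = path-variation k {f ∘ suc} {d ∘ suc} {λ i j → b (suc i) (suc j)} (d≤b ∘ suc)
    λ { i j (inj₁ e) → step (suc i) (suc j) (inj₁ (cong suc e))
      ; i j (inj₂ e) → step (suc i) (suc j) (inj₂ (cong suc e)) }
  -- `r` is the entry of `b` spent on the edge between the first two vertices; it is 0 if `p` and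
  -- `q` lie on the same side of that edge.
  combine : ∀ {r x y} → r ≤ R ℕ.+ C → D ℕ.+ x ≤ y ℕ.+ S ℕ.+ r →
            d zero ℕ.+ D ℕ.+ x ≤ y ℕ.+ (b zero zero ℕ.+ R ℕ.+ (C ℕ.+ S))
  combine {r} {x} {y} r≤ h = subst₂ _≤_ (sym (ℕ.+-assoc (d zero) D x)) (eq (b zero zero) y S R C)
    (ℕ.+-mono-≤ (d≤b zero) (ℕ.≤-trans h (ℕ.+-monoʳ-≤ (y ℕ.+ S) r≤)))
    where
    eq : ∀ b y s r c → b ℕ.+ (y ℕ.+ s ℕ.+ (r ℕ.+ c)) ≡ y ℕ.+ (b ℕ.+ r ℕ.+ (c ℕ.+ s))
    eq = solve-∀
  go : ∀ p q → d zero ℕ.+ D ℕ.+ f p ≤ f q ℕ.+ (b zero zero ℕ.+ R ℕ.+ (C ℕ.+ S))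
  go zero zero = combine {0} {f zero} {f zero} ℕ.z≤n (ℕ.≤-trans (ℕ.+-monoˡ-≤ (f zero) D≤S)
    (ℕ.≤-reflexive (trans (ℕ.+-comm S (f zero)) (sym (ℕ.+-identityʳ _)))))
  go (suc p) (suc q) = combine {0} {f (suc p)} {f (suc q)} ℕ.z≤n
    (ℕ.≤-trans (rec p q) (ℕ.≤-reflexive (sym (ℕ.+-identityʳ _))))
  go zero (suc q) = let i , adj = neighbour q in
    combine {b zero (suc i)} {f zero} {f (suc q)}
      (ℕ.≤-trans (sumOver-∈ (λ j → b zero (suc j)) (∈-allFin i)) (ℕ.m≤m+n R C))
      (ℕ.≤-trans (ℕ.+-monoʳ-≤ D (step zero (suc i) adj))
        (ℕ.≤-trans (ℕ.≤-reflexive (sym (ℕ.+-assoc D _ _))) (ℕ.+-monoˡ-≤ _ (rec i q))))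
  go (suc p) zero = let i , adj = neighbour p in
    combine {b (suc i) zero} {f (suc p)} {f zero}
      (ℕ.≤-trans (sumOver-∈ (λ i → b (suc i) zero) (∈-allFin i)) (ℕ.m≤n+m C R))
      (ℕ.≤-trans (rec p i) (ℕ.≤-trans (ℕ.+-monoˡ-≤ S (step (suc i) zero (Graph.symmetric (Path (suc k)) {zero} {suc i} adj)))
        (ℕ.≤-reflexive (eq (f zero) (b (suc i) zero) S))))
    where
    eq : ∀ x y z → x ℕ.+ y ℕ.+ z ≡ x ℕ.+ z ℕ.+ y
    eq = solve-∀

edge : ∀ G → VertexSet G → Graph.Vertex G → Graph.Vertex G → Bool
edge G A u v = A u ∧ not (A v) ∧ ⌊ Graph.adj? G u v ⌋

boundary-sum : ∀ G A → boundary G A ≡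
  sumOver (Graph.vertices G) λ u → sumOver (Graph.vertices G) λ v → [ edge G A u v ]
boundary-sum G A = trans (length-filterᵇ _ (cartesianProduct (Graph.vertices G) (Graph.vertices G)))
  (sumOver-cartesianProductWith _,_ (Graph.vertices G) (Graph.vertices G) _)

T-∧⁺ : ∀ {a b} → T a → T b → T (a ∧ b)
T-∧⁺ h k = Equivalence.from T-∧ (h , k)

T-∧⁻ : ∀ {a b} → T (a ∧ b) → T a × T b
T-∧⁻ = Equivalence.to T-∧

module _ (G : Graph) (n : ℕ) (A : VertexSet (G □^ suc n)) where

  open Graph G

  private
    H : Graph
    H = G □^ n
    vs : List (Vec Vertex n)
    vs = Graph.vertices H

  slice : Vertex → VertexSet H
  slice i u = A (i ∷ u)

  crossing : Vertex → Vertex → ℕ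
  crossing i j = sumOver vs λ u → sumOver vs λ v → [ edge (G □^ suc n) A (i ∷ u) (j ∷ v) ]

  card-slices : card (G □^ suc n) A ≡ sumOver vertices λ i → card H (slice i)
  card-slices = trans (length-filterᵇ A (Graph.vertices (G □^ suc n)))
    (trans (sumOver-cartesianProductWith _∷_ vertices vs ([_] ∘ A))
      (sumOver-cong vertices λ i → sym (length-filterᵇ (slice i) vs)))

  boundary-slices : boundary (G □^ suc n) A ≡ sumOver vertices λ i → sumOver vertices (crossing i)
  boundary-slices = trans (boundary-sum (G □^ suc n) A)
    (trans (sumOver-cartesianProductWith _∷_ vertices vs _) (sumOver-cong vertices λ i →
      trans (sumOver-cong vs λ u → sumOver-cartesianProductWith _∷_ vertices vs _)
        (sumOver-swap vs vertices _)))

  boundary-slice : ∀ i → boundary H (slice i) ≤ crossing i i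
  boundary-slice i = subst (_≤ crossing i i) (sym (boundary-sum H (slice i)))
    (sumOver-mono vs λ u → sumOver-mono vs λ v → []-mono {edge H (slice i) u v} λ h →
      let a , h′ = T-∧⁻ {A (i ∷ u)} h
          b , e  = T-∧⁻ {not (A (i ∷ v))} h′
      in T-∧⁺ a (T-∧⁺ b (fromWitness (lift (toWitness e)))))
    where
    lift : ∀ {u v} → Graph.Adj H u v → Graph.Adj (G □^ suc n) (i ∷ u) (i ∷ v)
    lift (j , a , h) = suc j , a , λ { zero _ → refl ; (suc l) l≢ → h l (l≢ ∘ cong suc) }

  -- A point u of `slice i` outside `slice j` yields the boundary edge from i ∷ u to j ∷ u, and
  -- different u yield different edges.
  card-crossing : ∀ i j → Adj i j → card H (slice i) ≤ card H (slice j) ℕ.+ crossing i j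
  card-crossing i j i~j = subst₂ (λ a b → a ≤ b ℕ.+ crossing i j)
    (sym (length-filterᵇ (slice i) vs)) (sym (length-filterᵇ (slice j) vs))
    (subst (sumOver vs ([_] ∘ slice i) ≤_) (sumOver-+ vs ([_] ∘ slice j) _)
      (sumOver-mono vs λ u → cases (A (i ∷ u)) (A (j ∷ u)) λ a b →
        ℕ.≤-trans ([]-mono {true} λ _ → T-∧⁺ a (T-∧⁺ b (fromWitness (vertical u))))
          (sumOver-∈ (λ v → [ edge (G □^ suc n) A (i ∷ u) (j ∷ v) ]) (Graph.complete H u))))
    where
    vertical : ∀ u → Graph.Adj (G □^ suc n) (i ∷ u) (j ∷ u)
    vertical u = zero , i~j , λ { zero z≢z → contradiction refl z≢z ; (suc l) _ → refl }
    cases : ∀ a b {r} → (T a → T (not b) → 1 ≤ r) → [ a ] ≤ [ b ] ℕ.+ r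
    cases false b     h = ℕ.z≤n
    cases true  true  h = ℕ.m≤m+n 1 _
    cases true  false h = h _ _

-- Induction on the dimension of the grid

ln : ℕ → Term
ln n = real (log (fromℕ n))

NonNeg-ln : ∀ {n} → 1 ≤ n → NonNeg (ln n)
NonNeg-ln = NonNeg-log ∘ 1≤fromℕ

-- With subtraction: M (1 + y - ln M) ≤ b, the tangent of exp at ln M taken at the point y.
ln-tangent : ∀ {M y b} → 1 ≤ M → NonNeg y → Exp y ≼ b → nat M ⊗ (rat 1ℚ ⊕ y) ≼ b ⊕ nat M ⊗ ln M
ln-tangent 1≤M 0≤y = exp-tangent′ (NonNeg-ln 1≤M) 0≤y (≼exp-log (1≤fromℕ 1≤M)) (exp-log≼ (1≤fromℕ 1≤M))

⊗-mono : ∀ {x y z w} → NonNeg x → NonNeg w → x ≼ y → z ≼ w → x ⊗ z ≼ y ⊗ w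
⊗-mono {x} {y} {z} {w} 0≤x 0≤w x≼y z≼w =
  x ⊗ z  ≼⟨ ⊗-monoʳ 0≤x z≼w ⟩
  x ⊗ w  ≼⟨ ⊗-monoˡ 0≤w x≼y ⟩
  y ⊗ w  ∎

exp-ln+ln : ∀ {m M} → 1 ≤ m → 1 ≤ M → Exp (ln m ⊕ ln M) ≼ nat m ⊗ nat M
exp-ln+ln {m} {M} 1≤m 1≤M =
  Exp (ln m ⊕ ln M)          ≼⟨ exp-+≤ (NonNeg-ln 1≤m) (NonNeg-ln 1≤M) ⟩
  Exp (ln m) ⊗ Exp (ln M)    ≼⟨ ⊗-mono (NonNeg-exp (NonNeg-ln 1≤m)) (NonNeg-nat M)
                                  (exp-log≼ (1≤fromℕ 1≤m)) (exp-log≼ (1≤fromℕ 1≤M)) ⟩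
  nat m ⊗ nat M              ∎

sumOver-≼ : ∀ {X : Set} (xs : List X) {f g : X → ℕ} {a b c d} →
  (∀ x → a ⊗ nat (f x) ⊕ b ≼ c ⊗ nat (f x) ⊕ d ⊗ nat (g x)) →
  a ⊗ nat (sumOver xs f) ⊕ nat (length xs) ⊗ b ≼ c ⊗ nat (sumOver xs f) ⊕ d ⊗ nat (sumOver xs g)
sumOver-≼ [] {a = a} {b} {c} {d} h = ≼-reflexive λ i → eq (val a i) (val b i) (val c i) (val d i)
  where
  eq : ∀ a b c d → a * 0ℚ + 0ℚ * b ≡ c * 0ℚ + d * 0ℚ
  eq = solve 4 (λ a b c d → a :* con 0ℚ :+ con 0ℚ :* b := c :* con 0ℚ :+ d :* con 0ℚ) refl
sumOver-≼ (x ∷ xs) {f} {g} {a} {b} {c} {d} h = ≼-rearrange (⊕-mono (h x) (sumOver-≼ xs {f} {g} {a} {b} {c} {d} h)) λ i →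
  eq (val a i) (val b i) (val c i) (val d i) (fromℕ (f x)) (fromℕ (sumOver xs f))
    (fromℕ (g x)) (fromℕ (sumOver xs g)) (fromℕ (length xs)) (fromℕ-+ (f x) (sumOver xs f)) (fromℕ-+ (g x) (sumOver xs g)) (fromℕ-suc (length xs))
  where
  eq′ : ∀ a b c d f F g G k →
    a * (f + F) + (1ℚ + k) * b + (c * f + d * g + (c * F + d * G)) ≡
    a * f + b + (a * F + k * b) + (c * (f + F) + d * (g + G))
  eq′ = solve 9 (λ a b c d f F g G k →
    a :* (f :+ F) :+ (con 1ℚ :+ k) :* b :+ (c :* f :+ d :* g :+ (c :* F :+ d :* G)) :=
    a :* f :+ b :+ (a :* F :+ k :* b) :+ (c :* (f :+ F) :+ d :* (g :+ G))) refl
  eq : ∀ a b c d f F g G k {fF gG sk} → fF ≡ f + F → gG ≡ g + G → sk ≡ 1ℚ + k →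
    a * fF + sk * b + (c * f + d * g + (c * F + d * G)) ≡ a * f + b + (a * F + k * b) + (c * fF + d * gG)
  eq a b c d f F g G k refl refl refl = eq′ a b c d f F g G k

module Induction (k : ℕ) {τ W : Term} (0≤W : NonNeg W)
  (τ-tangent : ∀ {M N} → 1 ≤ M → 1 ≤ N → nat N ⊗ (τ ⊕ ln M) ≼ W ⊗ nat M ⊕ nat N ⊗ ln N)
  (τ≼ln : τ ≼ ln (suc k)) where

  m : ℕ
  m = suc k

  Bound : ℕ → ℕ → ℕ → Set
  Bound n N e = nat n ⊗ (nat N ⊗ τ) ≼ W ⊗ nat e ⊕ nat N ⊗ ln N

  -- For an empty set the product N ln N vanishes whatever value ln 0 has.
  bound-empty : ∀ n {N} e → N ≡ 0 → Bound n N e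
  bound-empty n e refl = ≼-pointwise λ i → ≤-from-gap (val W i * fromℕ e)
    (0≤* (0≤val 0≤W i) (0≤fromℕ e)) (eq (fromℕ n) (val τ i) (val W i) (fromℕ e) (val (ln 0) i))
    where
    eq : ∀ n τ w e l → w * e + 0ℚ * l ≡ n * (0ℚ * τ) + w * e
    eq = solve 5 (λ n τ w e l → w :* e :+ con 0ℚ :* l := n :* (con 0ℚ :* τ) :+ w :* e) refl

  bound-zero : ∀ {N e} → 1 ≤ N → Bound 0 N e
  bound-zero {N} {e} 1≤N = ≼-pointwise λ i → subst (ℚ._≤ val (W ⊗ nat e ⊕ nat N ⊗ ln N) i)
    (sym (ℚ.*-zeroˡ (fromℕ N * val τ i)))
    (0≤val (NonNeg-+ (NonNeg-* 0≤W (NonNeg-nat e)) (NonNeg-* (NonNeg-nat N) (NonNeg-ln 1≤N))) i)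

  -- To be summed over the slices, the bound has to be linear in N, so N ln N is replaced in two
  -- steps. The tangent at ln M gives M N ln N ≤ M N ln M + N (N - M). For c ≤ N ≤ M the convex N (N
  -- - M) lies below its chord c (N - M), which is `spread`.
  bound-slice : ∀ n {c M N e} → 1 ≤ M → c ≤ N → N ≤ M → Bound n N e →
    nat M ⊗ (nat n ⊗ τ) ⊗ nat N ⊕ nat c ⊗ nat M ≼ (nat M ⊗ ln M ⊕ nat c) ⊗ nat N ⊕ nat M ⊗ W ⊗ nat e
  bound-slice n {c} {M} {N} {e} 1≤M c≤N N≤M h = ≼-rearrange
    (⊕-mono (⊕-mono (⊗-monoʳ (NonNeg-nat M) h) (tangent N)) spread)
    λ i → eq (fromℕ M) (fromℕ n) (val τ i) (fromℕ N) (fromℕ c) (val (ln M) i) (val (ln N) i) (val W i) (fromℕ e)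
    where
    tangent : ∀ N → nat N ⊗ (nat M ⊗ (rat 1ℚ ⊕ ln N)) ≼ nat N ⊗ (nat N ⊕ nat M ⊗ ln M)
    -- An empty slice has no usable logarithm, but the factor N makes both sides 0.
    tangent zero    = ≼-reflexive λ i → trans (ℚ.*-zeroˡ (val (nat M ⊗ (rat 1ℚ ⊕ ln 0)) i))
      (sym (ℚ.*-zeroˡ (val (nat 0 ⊕ nat M ⊗ ln M) i)))
    tangent (suc N) = ⊗-monoʳ (NonNeg-nat (suc N))
      (ln-tangent 1≤M (NonNeg-ln {suc N} (ℕ.s≤s ℕ.z≤n)) (exp-log≼ (1≤fromℕ {suc N} (ℕ.s≤s ℕ.z≤n))))
    spread : rat (fromℕ N * fromℕ N + fromℕ c * fromℕ M) ≼ rat (fromℕ N * fromℕ M + fromℕ c * fromℕ N)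
    spread = ≼-pointwise λ _ → ≤-from-gap _ (0≤* (gap (fromℕ-mono c≤N)) (gap (fromℕ-mono N≤M)))
      (eq₁ (fromℕ N) (fromℕ M) (fromℕ c))
      where
      eq₁ : ∀ N M c → N * M + c * N ≡ N * N + c * M + (N - c) * (M - N)
      eq₁ = solve 3 (λ N M c → N :* M :+ c :* N := N :* N :+ c :* M :+ (N :- c) :* (M :- N)) refl
    eq : ∀ M n τ N c l L w e →
      M * (n * τ) * N + c * M + (M * (w * e + N * L) + N * (N + M * l) + (N * M + c * N)) ≡
      M * (n * (N * τ)) + N * (M * (1ℚ + L)) + (N * N + c * M) + ((M * l + c) * N + M * w * e)
    eq = solve 9 (λ M n τ N c l L w e →
      M :* (n :* τ) :* N :+ c :* M :+ (M :* (w :* e :+ N :* L) :+ N :* (N :+ M :* l) :+ (N :* M :+ c :* N)) :=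
      M :* (n :* (N :* τ)) :+ N :* (M :* (con 1ℚ :+ L)) :+ (N :* N :+ c :* M) :+ ((M :* l :+ c) :* N :+ M :* w :* e)) refl

  -- With M and c the largest and smallest slice, Q = N (τ + ln M - ln N) is at most
  -- W M and at most m M - N; these enter with weights M - c and c.
  bound-suc : ∀ n (f e : Fin m → ℕ) {c d E} → let N = sumOver (allFin m) f in
    1 ≤ c ℕ.+ d → 1 ≤ N → (∀ i → c ≤ f i) → (∀ i → f i ≤ c ℕ.+ d) →
    (∀ i → Bound n (f i) (e i)) → sumOver (allFin m) e ℕ.+ d ≤ E → Bound (suc n) N E
  bound-suc n f e {c} {d} {E} 1≤M 1≤N c≤ ≤M h e≤E =
    ⊗-cancelˡ {z = nat M} (λ _ → 1≤fromℕ 1≤M) (≼-rearrange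
      (⊕-mono (⊕-mono (sumOver-≼ (allFin m) {f} {e} λ i → bound-slice n {e = e i} 1≤M (c≤ i) (≤M i) (h i))
                      (⊗-monoʳ (NonNeg-nat d) (τ-tangent 1≤M 1≤N)))
              (⊕-mono (⊗-monoʳ (NonNeg-nat c) m-tangent)
                      (⊗-monoʳ (NonNeg-* (NonNeg-nat M) 0≤W) edges)))
      λ i → eq (fromℕ M) (fromℕ n) (val τ i) (fromℕ N) (fromℕ (length (allFin m))) (fromℕ c) (fromℕ d)
              (val (ln M) i) (val (ln N) i) (val W i) (fromℕ (sumOver (allFin m) e)) (fromℕ E)
              (fromℕ-+ c d) (fromℕ-suc n) (cong fromℕ (List.length-tabulate {n = m} id)))
    where
    M N : ℕ
    M = c ℕ.+ d
    N = sumOver (allFin m) f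
    1≤m : 1 ≤ m
    1≤m = ℕ.s≤s ℕ.z≤n
    -- The tangent of exp at ln N, taken at ln m + ln M, is N (1 + ln m + ln M - ln N) ≤ m M; `τ≼ln`
    -- turns it into Q ≤ m M - N.
    m-tangent : nat N ⊗ (rat 1ℚ ⊕ (τ ⊕ ln M)) ≼ nat m ⊗ nat M ⊕ nat N ⊗ ln N
    m-tangent =
      nat N ⊗ (rat 1ℚ ⊕ (τ ⊕ ln M))      ≼⟨ ⊗-monoʳ (NonNeg-nat N) (⊕-mono ≼-refl (⊕-mono τ≼ln ≼-refl)) ⟩
      nat N ⊗ (rat 1ℚ ⊕ (ln m ⊕ ln M))   ≼⟨ ln-tangent 1≤N (NonNeg-+ (NonNeg-ln 1≤m) (NonNeg-ln 1≤M)) (exp-ln+ln 1≤m 1≤M) ⟩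
      nat m ⊗ nat M ⊕ nat N ⊗ ln N       ∎
    edges : nat (sumOver (allFin m) e) ⊕ nat d ≼ nat E
    edges = ≼-pointwise λ _ → subst (ℚ._≤ fromℕ E) (fromℕ-+ (sumOver (allFin m) e) d) (fromℕ-mono e≤E)
    eq′ : ∀ n τ N m c d l L w s E → let M = c + d in
      M * ((1ℚ + n) * (N * τ)) +
        ((M * l + c) * N + M * w * s + d * (w * M + N * L) + (c * (m * M + N * L) + M * w * E)) ≡
      M * (n * τ) * N + m * (c * M) + d * (N * (τ + l)) + (c * (N * (1ℚ + (τ + l))) + M * w * (s + d)) +
        M * (w * E + N * L)
    eq′ = solve 11 (λ n τ N m c d l L w s E → let M = c :+ d in
      M :* ((con 1ℚ :+ n) :* (N :* τ)) :+
        ((M :* l :+ c) :* N :+ M :* w :* s :+ d :* (w :* M :+ N :* L) :+ (c :* (m :* M :+ N :* L) :+ M :* w :* E)) :=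
      M :* (n :* τ) :* N :+ m :* (c :* M) :+ d :* (N :* (τ :+ l)) :+ (c :* (N :* (con 1ℚ :+ (τ :+ l))) :+ M :* w :* (s :+ d)) :+
        M :* (w :* E :+ N :* L)) refl
    eq : ∀ M n τ N ℓ c d l L w s E {sn m} → M ≡ c + d → sn ≡ 1ℚ + n → ℓ ≡ m →
      M * (sn * (N * τ)) +
        ((M * l + c) * N + M * w * s + d * (w * M + N * L) + (c * (m * M + N * L) + M * w * E)) ≡
      M * (n * τ) * N + ℓ * (c * M) + d * (N * (τ + l)) + (c * (N * (1ℚ + (τ + l))) + M * w * (s + d)) +
        M * (w * E + N * L)
    eq .(c + d) n τ N ℓ c d l L w s E refl refl refl = eq′ n τ N ℓ c d l L w s E

  zero-or-positive : ∀ n → n ≡ 0 ⊎ 1 ≤ n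
  zero-or-positive zero    = inj₁ refl
  zero-or-positive (suc n) = inj₂ (ℕ.s≤s ℕ.z≤n)

  module _ n (A : VertexSet (Path m □^ suc n))
           (1≤N : 1 ≤ card (Path m □^ suc n) A)
           (h : ∀ B → Bound n (card (Path m □^ n) B) (boundary (Path m □^ n) B)) where

    private
      P : Graph
      P = Path m
      E : ℕ
      E = boundary (P □^ suc n) A
      f g : Fin m → ℕ
      f i = card (P □^ n) (slice P n A i)
      g i = boundary (P □^ n) (slice P n A i)
      N≡ : card (P □^ suc n) A ≡ sumOver (allFin m) f
      N≡ = card-slices P n A
      p q : Fin m
      p = argmax f zero (allFin m)
      q = argmin f zero (allFin m)
      p-max : ∀ i → f i ≤ f p
      p-max i = All.lookup (f[xs]≤f[argmax] {f = f} zero (allFin m)) (∈-allFin i)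
      q-min : ∀ i → f q ≤ f i
      q-min i = All.lookup (f[argmin]≤f[xs] {f = f} zero (allFin m)) (∈-allFin i)
      d : ℕ
      d = f p ℕ.∸ f q
      q+d : f q ℕ.+ d ≡ f p
      q+d = ℕ.m+[n∸m]≡n (q-min p)
      1≤fp : 1 ≤ f p
      1≤fp = [ (λ fp≡0 → contradiction (trans N≡ (trans
          (sumOver-cong (allFin m) {f} {λ _ → 0} λ i → ℕ.n≤0⇒n≡0 (subst (f i ≤_) fp≡0 (p-max i)))
          (sumOver-0 (allFin m)))) (ℕ.>⇒≢ 1≤N))
        , id ]′ (zero-or-positive (f p))
      variation : sumOver (allFin m) g ℕ.+ f p ≤ f q ℕ.+ E
      variation = subst (λ E → sumOver (allFin m) g ℕ.+ f p ≤ f q ℕ.+ E) (sym (boundary-slices P n A))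
        (path-variation m {f} {g} {crossing P n A} (boundary-slice P n A) (card-crossing P n A) p q)
      regroup : ∀ s → f q ℕ.+ (s ℕ.+ d) ≡ s ℕ.+ f p
      regroup s = trans (eq (f q) s d) (cong (s ℕ.+_) q+d)
        where
        eq : ∀ a b c → a ℕ.+ (b ℕ.+ c) ≡ b ℕ.+ (a ℕ.+ c)
        eq = solve-∀
      edges : sumOver (allFin m) g ℕ.+ d ≤ E
      edges = ℕ.+-cancelˡ-≤ (f q) (sumOver (allFin m) g ℕ.+ d) E
        (subst (_≤ f q ℕ.+ E) (sym (regroup (sumOver (allFin m) g))) variation)

    bound-by-slices : Bound (suc n) (card (P □^ suc n) A) E
    bound-by-slices = subst (λ N → Bound (suc n) N E) (sym N≡)
      (bound-suc n f g {f q} {d} {E} (subst (1 ≤_) (sym q+d) 1≤fp) (subst (1 ≤_) N≡ 1≤N)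
        q-min (λ i → subst (f i ≤_) (sym q+d) (p-max i)) (λ i → h (slice P n A i)) edges)

  bound : ∀ n (A : VertexSet (Path m □^ n)) → Bound n (card (Path m □^ n) A) (boundary (Path m □^ n) A)
  bound n A = by-cases n A (zero-or-positive (card (Path m □^ n) A))
    where
    by-cases : ∀ n (A : VertexSet (Path m □^ n)) →
      card (Path m □^ n) A ≡ 0 ⊎ 1 ≤ card (Path m □^ n) A →
      Bound n (card (Path m □^ n) A) (boundary (Path m □^ n) A)
    by-cases n       A (inj₁ N≡0) = bound-empty n (boundary (Path m □^ n) A) N≡0
    by-cases zero    A (inj₂ 1≤N) = bound-zero {e = boundary (Path m □^ zero) A} 1≤N
    by-cases (suc n) A (inj₂ 1≤N) = bound-by-slices n A 1≤N
      λ B → by-cases n B (zero-or-positive (card (Path m □^ n) B))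

-- The two choices of `W` and `τ`

-- For ring identities that hold only modulo z = 1, with z a product such as n * (1 / n): the solver
-- proves them with an explicit multiple of z - 1 added.
drop-unit : ∀ {a b z c} → z ≡ 1ℚ → a ≡ b + (z - 1ℚ) * c → a ≡ b
drop-unit {a} {b} {_} {c} refl h = trans h (eq b c)
  where
  eq : ∀ b c → b + (1ℚ - 1ℚ) * c ≡ b
  eq = solve 2 (λ b c → b :+ (con 1ℚ :- con 1ℚ) :* c := b) refl

E : Term
E = Exp (rat 1ℚ)

NonNeg-E : NonNeg E
NonNeg-E = NonNeg-exp NonNeg-1

0<val-E : ∀ i → 0ℚ ℚ.< val E i
0<val-E i = ℚ.<-≤-trans 0<1 (1≤exp NonNeg-1 i)

fromℕ-*-recip : ∀ {n} → 1 ≤ n → fromℕ n * recip (fromℕ n) ≡ 1ℚ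
fromℕ-*-recip 1≤n = *-recip (ℚ.<-≤-trans 0<1 (1≤fromℕ 1≤n))

0≤recip : ∀ {n} → 1 ≤ n → 0ℚ ℚ.≤ recip (fromℕ n)
0≤recip 1≤n = ℚ.<⇒≤ (0<recip (ℚ.<-≤-trans 0<1 (1≤fromℕ 1≤n)))

exp-suc-ln : ∀ n {m} → 1 ≤ m → nat m ⊗ Exp (nat n ⊗ ln m) ≼ Exp (nat (suc n) ⊗ ln m)
exp-suc-ln n {m} 1≤m =
  nat m ⊗ Exp (nat n ⊗ ln m)         ≼⟨ ⊗-monoˡ (NonNeg-exp 0≤nl) (≼exp-log (1≤fromℕ 1≤m)) ⟩
  Exp (ln m) ⊗ Exp (nat n ⊗ ln m)    ≼⟨ exp-*≤ (NonNeg-ln 1≤m) 0≤nl ⟩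
  Exp (ln m ⊕ nat n ⊗ ln m)          ≼⟨ exp-cong (λ i → trans (eq (val (ln m) i) (fromℕ n)) (cong (_* val (ln m) i) (sym (fromℕ-suc n)))) ⟩
  Exp (nat (suc n) ⊗ ln m)           ∎
  where
  0≤nl : NonNeg (nat n ⊗ ln m)
  0≤nl = NonNeg-* (NonNeg-nat n) (NonNeg-ln 1≤m)
  eq : ∀ l n → l + n * l ≡ (1ℚ + n) * l
  eq = solve 2 (λ l n → l :+ n :* l := (con 1ℚ :+ n) :* l) refl

^≼exp-ln : ∀ n {m} → 1 ≤ m → nat (m ^ n) ≼ Exp (nat n ⊗ ln m)
^≼exp-ln zero    {m} 1≤m = ≼-pointwise (1≤exp {nat 0 ⊗ ln m} (NonNeg-* (NonNeg-nat 0) (NonNeg-ln 1≤m)))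
^≼exp-ln (suc n) {m} 1≤m =
  nat (m ^ suc n)               ≼⟨ ≼-reflexive (λ _ → fromℕ-* m (m ^ n)) ⟩
  nat m ⊗ nat (m ^ n)           ≼⟨ ⊗-monoʳ (NonNeg-nat m) (^≼exp-ln n 1≤m) ⟩
  nat m ⊗ Exp (nat n ⊗ ln m)    ≼⟨ exp-suc-ln n 1≤m ⟩
  Exp (nat (suc n) ⊗ ln m)      ∎

-- Division acts on the approximants, so where the denominator is positive the quotient is an exact
-- rational one and the default `recip` 0 = 0 is avoided. For the denominator e this holds at every
-- index.
*-÷ℝ : ∀ x y 0<y i → 0ℚ ℚ.< seq y i → seq y i * seq (x ÷ℝ (y , 0<y)) i ≡ seq x i
*-÷ℝ x y 0<y i 0<yᵢ = trans (eq (seq x i) (seq y i) (recip (seq y i)))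
  (trans (cong (seq x i *_) (*-recip 0<yᵢ)) (ℚ.*-identityʳ (seq x i)))
  where
  eq : ∀ x y r → y * (x * r) ≡ x * (y * r)
  eq = solve 3 (λ x y r → y :* (x :* r) := x :* (y :* r)) refl

NonNeg-÷ℝ : ∀ x y 0<y → NonNeg (real x) → (∀ i → 0ℚ ℚ.< seq y i) → NonNeg (real (x ÷ℝ (y , 0<y)))
NonNeg-÷ℝ x y 0<y (nonNeg 0≤x) 0<yᵢ = nonNeg λ i → 0≤* (0≤x i) (ℚ.<⇒≤ (0<recip (0<yᵢ i)))

NonNeg-^ : ∀ {x} → NonNeg (real x) → ∀ n → NonNeg (real (x ^ℝ n))
NonNeg-^ 0≤x zero = nonNeg λ _ → 0≤1
NonNeg-^ {x} (nonNeg 0≤x) (suc n) = nonNeg λ i → 0≤* (0≤x i) (0≤val (NonNeg-^ {x} (nonNeg 0≤x) n) i)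

-- For w = m / e this is eⁿ (m/e)ⁿ ≤ mⁿ, with the right side already in exponential form for
-- `exp-cancel-≼`.
exp*^ : ∀ n {m w} → 1 ≤ m → NonNeg (real w) → (∀ i → val E i * seq w i ≡ fromℕ m) →
        Exp (nat n) ⊗ real (w ^ℝ n) ≼ Exp (nat n ⊗ ln m)
exp*^ zero {m} 1≤m 0≤w E*w = ≼-reflexive λ i → trans (ℚ.*-identityʳ (expSum i 0ℚ))
  (cong (expSum i) (sym (ℚ.*-zeroˡ (val (ln m) i))))
exp*^ (suc n) {m} {w} 1≤m 0≤w E*w =
  Exp (nat (suc n)) ⊗ power (suc n)        ≼⟨ ⊗-monoˡ (NonNeg-^ 0≤w (suc n)) (exp-cong λ _ → fromℕ-suc n) ⟩
  Exp (rat 1ℚ ⊕ nat n) ⊗ power (suc n)     ≼⟨ ⊗-monoˡ (NonNeg-^ 0≤w (suc n)) (exp-+≤ NonNeg-1 (NonNeg-nat n)) ⟩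
  E ⊗ Exp (nat n) ⊗ power (suc n)          ≼⟨ ≼-reflexive (λ i → trans
                                                (eq (val E i) (val (Exp (nat n)) i) (seq w i) (val (power n) i))
                                                (cong (_* (val (Exp (nat n)) i * val (power n) i)) (E*w i))) ⟩
  nat m ⊗ (Exp (nat n) ⊗ power n)          ≼⟨ ⊗-monoʳ (NonNeg-nat m) (exp*^ n 1≤m 0≤w E*w) ⟩
  nat m ⊗ Exp (nat n ⊗ ln m)               ≼⟨ exp-suc-ln n 1≤m ⟩
  Exp (nat (suc n) ⊗ ln m)                 ∎
  where
  power : ℕ → Term
  power n = real (w ^ℝ n)
  eq : ∀ E x w p → E * x * (w * p) ≡ E * w * (x * p)
  eq = solve 4 (λ E x w p → E :* x :* (w :* p) := E :* w :* (x :* p)) refl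

module _ (k : ℕ) (w : ℝ) (0≤w : NonNeg (real w)) (E*w : ∀ i → val E i * seq w i ≡ fromℕ (suc k)) where

  -- The bound at W = |A|^(1/n), τ = 1 + ln |A| / n.
  small-sets : ∀ n (A : VertexSet (Path (suc k) □^ n)) → 1 ≤ n → 1 ≤ card (Path (suc k) □^ n) A →
    nat (card (Path (suc k) □^ n) A) ≼ real (w ^ℝ n) →
    nat n ⊗ Exp (rat (1ℚ - 1 /₀ n) ⊗ ln (card (Path (suc k) □^ n) A)) ≼ nat (boundary (Path (suc k) □^ n) A)
  small-sets n A 1≤n 1≤N N≼ = conclude (card (Path m □^ n) A) (boundary (Path m □^ n) A) 1≤N N≼
      (λ {τ} {W} 0≤W τ-tangent τ≼ln → Induction.bound k {τ} {W} 0≤W τ-tangent τ≼ln n A)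
    where
    m : ℕ
    m = suc k
    1≤m : 1 ≤ m
    1≤m = ℕ.s≤s ℕ.z≤n
    r : ℚ
    r = 1 /₀ n
    0≤r : 0ℚ ℚ.≤ r
    0≤r = 0≤* 0≤1 (0≤recip 1≤n)
    n*r : fromℕ n * r ≡ 1ℚ
    n*r = trans (cong (fromℕ n *_) (ℚ.*-identityˡ (recip (fromℕ n)))) (fromℕ-*-recip 1≤n)
    r≤1 : r ℚ.≤ 1ℚ
    r≤1 = ≤-from-gap (r * (fromℕ n - 1ℚ)) (0≤* 0≤r (gap (1≤fromℕ 1≤n))) (trans (sym n*r) (eq r (fromℕ n)))
      where
      eq : ∀ r n → n * r ≡ r + r * (n - 1ℚ)
      eq = solve 2 (λ r n → n :* r := r :+ r :* (n :- con 1ℚ)) refl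
    conclude : ∀ N b → 1 ≤ N → nat N ≼ real (w ^ℝ n) →
      (∀ {τ W} → NonNeg W →
        (∀ {M N} → 1 ≤ M → 1 ≤ N → nat N ⊗ (τ ⊕ ln M) ≼ W ⊗ nat M ⊕ nat N ⊗ ln N) →
        τ ≼ ln m → nat n ⊗ (nat N ⊗ τ) ≼ W ⊗ nat b ⊕ nat N ⊗ ln N) →
      nat n ⊗ Exp (rat (1ℚ - r) ⊗ ln N) ≼ nat b
    -- Here W = N^(1/n) and Exp ρ = N^(1 - 1/n) have product N, so multiplying by W reduces the
    -- claim to n N ≤ W b. This is `bound`: since n σ = ln N, its left side is n N + N ln N, and N
    -- ln N cancels.
    conclude N b 1≤N N≼ bound = ⊗-cancelˡ {z = W} (1≤exp 0≤σ) (
      W ⊗ (nat n ⊗ Exp ρ)      ≼⟨ ≼-reflexive (λ i → eq₁ (val W i) (fromℕ n) (val (Exp ρ) i)) ⟩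
      nat n ⊗ (W ⊗ Exp ρ)      ≼⟨ ⊗-monoʳ (NonNeg-nat n) (exp-*≤ 0≤σ 0≤ρ) ⟩
      nat n ⊗ Exp (σ ⊕ ρ)      ≼⟨ ⊗-monoʳ (NonNeg-nat n) (exp-cong λ i → eq₂ r (val (ln N) i)) ⟩
      nat n ⊗ Exp (ln N)       ≼⟨ ⊗-monoʳ (NonNeg-nat n) (exp-log≼ (1≤fromℕ 1≤N)) ⟩
      nat n ⊗ nat N            ≼⟨ ≼-rearrange (bound 0≤W tangent τ≼ln) (λ i →
                                    drop-unit n*r (eq₃ (fromℕ n) (fromℕ N) r (val (ln N) i) (val W i) (fromℕ b))) ⟩
      W ⊗ nat b                ∎)
      where
      σ ρ W : Term
      σ = rat r ⊗ ln N
      ρ = rat (1ℚ - r) ⊗ ln N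
      W = Exp σ
      0≤σ : NonNeg σ
      0≤σ = NonNeg-* (nonNeg λ _ → 0≤r) (NonNeg-ln 1≤N)
      0≤ρ : NonNeg ρ
      0≤ρ = NonNeg-* (nonNeg λ _ → gap r≤1) (NonNeg-ln 1≤N)
      0≤W : NonNeg W
      0≤W = NonNeg-exp 0≤σ
      -- This `N` is arbitrary and shadows the size of the set, which survives inside `σ` and `W`.
      tangent : ∀ {M N} → 1 ≤ M → 1 ≤ N → nat N ⊗ (rat 1ℚ ⊕ σ ⊕ ln M) ≼ W ⊗ nat M ⊕ nat N ⊗ ln N
      tangent {M} {N} 1≤M 1≤N =
        nat N ⊗ (rat 1ℚ ⊕ σ ⊕ ln M)     ≼⟨ ≼-reflexive (λ i → cong (fromℕ N *_) (ℚ.+-assoc 1ℚ (val σ i) (val (ln M) i))) ⟩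
        nat N ⊗ (rat 1ℚ ⊕ (σ ⊕ ln M))   ≼⟨ ln-tangent 1≤N (NonNeg-+ 0≤σ (NonNeg-ln 1≤M)) exp-σ+ln ⟩
        W ⊗ nat M ⊕ nat N ⊗ ln N        ∎
        where
        exp-σ+ln : Exp (σ ⊕ ln M) ≼ W ⊗ nat M
        exp-σ+ln =
          Exp (σ ⊕ ln M)     ≼⟨ exp-+≤ 0≤σ (NonNeg-ln 1≤M) ⟩
          W ⊗ Exp (ln M)     ≼⟨ ⊗-monoʳ 0≤W (exp-log≼ (1≤fromℕ 1≤M)) ⟩
          W ⊗ nat M          ∎
      -- The hypothesis N ≤ (m/e)ⁿ in logarithmic form; divided by n it becomes 1 + (ln N) / n ≤ ln
      -- m.
      n+ln≼ : nat n ⊕ ln N ≼ nat n ⊗ ln m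
      n+ln≼ = exp-cancel-≼ (NonNeg-+ (NonNeg-nat n) (NonNeg-ln 1≤N)) (NonNeg-* (NonNeg-nat n) (NonNeg-ln 1≤m)) (
        Exp (nat n ⊕ ln N)                  ≼⟨ exp-+≤ (NonNeg-nat n) (NonNeg-ln 1≤N) ⟩
        Exp (nat n) ⊗ Exp (ln N)            ≼⟨ ⊗-monoʳ (NonNeg-exp (NonNeg-nat n)) (exp-log≼ (1≤fromℕ 1≤N)) ⟩
        Exp (nat n) ⊗ nat N                 ≼⟨ ⊗-monoʳ (NonNeg-exp (NonNeg-nat n)) N≼ ⟩
        Exp (nat n) ⊗ real (w ^ℝ n)     ≼⟨ exp*^ n 1≤m 0≤w E*w ⟩
        Exp (nat n ⊗ ln m)                  ∎)
      τ≼ln : rat 1ℚ ⊕ σ ≼ ln m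
      τ≼ln = ≼-rearrange (⊗-monoʳ {z = rat r} (nonNeg λ _ → 0≤r) n+ln≼)
        λ i → drop-unit n*r (eq₄ (fromℕ n) r (val (ln N) i) (val (ln m) i))
        where
        eq₄ : ∀ n r l L → 1ℚ + r * l + r * (n * L) ≡ r * (n + l) + L + (n * r - 1ℚ) * (L - 1ℚ)
        eq₄ = solve 4 (λ n r l L → con 1ℚ :+ r :* l :+ r :* (n :* L) :=
          r :* (n :+ l) :+ L :+ (n :* r :- con 1ℚ) :* (L :- con 1ℚ)) refl
      eq₁ : ∀ w n x → w * (n * x) ≡ n * (w * x)
      eq₁ = solve 3 (λ w n x → w :* (n :* x) := n :* (w :* x)) refl
      eq₂ : ∀ r l → r * l + (1ℚ - r) * l ≡ l
      eq₂ = solve 2 (λ r l → r :* l :+ (con 1ℚ :- r) :* l := l) refl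
      eq₃ : ∀ n N r l w b →
        n * N + (w * b + N * l) ≡ n * (N * (1ℚ + r * l)) + w * b + (n * r - 1ℚ) * (- (N * l))
      eq₃ = solve 6 (λ n N r l w b → n :* N :+ (w :* b :+ N :* l) :=
        n :* (N :* (con 1ℚ :+ r :* l)) :+ w :* b :+ (n :* r :- con 1ℚ) :* (:- (N :* l))) refl

  -- The bound at W = m / e, τ = ln m.
  large-sets : ∀ n (A : VertexSet (Path (suc k) □^ n)) → 1 ≤ card (Path (suc k) □^ n) A →
    card (Path (suc k) □^ n) A ≤ suc k ^ n →
    rat (card (Path (suc k) □^ n) A /₀ suc k) ⊗ E ⊗ real (log ((suc k ^ n) /₀ card (Path (suc k) □^ n) A)) ≼
    nat (boundary (Path (suc k) □^ n) A)
  large-sets n A 1≤N N≤ = conclude (card (Path m □^ n) A) (boundary (Path m □^ n) A) 1≤N N≤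
      (Induction.bound k 0≤w tangent ≼-refl n A)
    where
    m : ℕ
    m = suc k
    1≤m : 1 ≤ m
    1≤m = ℕ.s≤s ℕ.z≤n
    W : Term
    W = real w
    -- The tangent of exp at 1 + ln N, where its value is e N, taken at ln m + ln M. The inequality
    -- is multiplied by e throughout and e * w = m, so no logarithm of m / e appears.
    tangent : ∀ {M N} → 1 ≤ M → 1 ≤ N → nat N ⊗ (ln m ⊕ ln M) ≼ W ⊗ nat M ⊕ nat N ⊗ ln N
    tangent {M} {N} 1≤M 1≤N = ⊗-cancelˡ {z = E} (1≤exp NonNeg-1) (≼-rearrange scaled λ i → trans
        (cong (λ x → val E i * (fromℕ N * (val (ln m) i + val (ln M) i)) + (x * fromℕ M + val E i * fromℕ N * (1ℚ + val (ln N) i)))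
          (sym (E*w i)))
        (eq (val E i) (seq w i) (fromℕ N) (val (ln m) i + val (ln M) i) (val (ln N) i) (fromℕ M)))
      where
      0≤l : NonNeg (ln N)
      0≤l = NonNeg-ln 1≤N
      scaled : E ⊗ nat N ⊗ (rat 1ℚ ⊕ (ln m ⊕ ln M)) ≼ nat m ⊗ nat M ⊕ E ⊗ nat N ⊗ (rat 1ℚ ⊕ ln N)
      scaled = exp-tangent′ (NonNeg-+ NonNeg-1 0≤l) (NonNeg-+ (NonNeg-ln 1≤m) (NonNeg-ln 1≤M))
        (E ⊗ nat N               ≼⟨ ⊗-monoʳ NonNeg-E (≼exp-log (1≤fromℕ 1≤N)) ⟩
         E ⊗ Exp (ln N)          ≼⟨ exp-*≤ NonNeg-1 0≤l ⟩
         Exp (rat 1ℚ ⊕ ln N)     ∎)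
        (Exp (rat 1ℚ ⊕ ln N)     ≼⟨ exp-+≤ NonNeg-1 0≤l ⟩
         E ⊗ Exp (ln N)          ≼⟨ ⊗-monoʳ NonNeg-E (exp-log≼ (1≤fromℕ 1≤N)) ⟩
         E ⊗ nat N               ∎)
        (exp-ln+ln 1≤m 1≤M)
      eq : ∀ E w N y l M → E * (N * y) + (E * w * M + E * N * (1ℚ + l)) ≡
        E * N * (1ℚ + y) + E * (w * M + N * l)
      eq = solve 6 (λ E w N y l M → E :* (N :* y) :+ (E :* w :* M :+ E :* N :* (con 1ℚ :+ l)) :=
        E :* N :* (con 1ℚ :+ y) :+ E :* (w :* M :+ N :* l)) refl
    conclude : ∀ N b → 1 ≤ N → N ≤ m ^ n → nat n ⊗ (nat N ⊗ ln m) ≼ W ⊗ nat b ⊕ nat N ⊗ ln N →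
      rat (N /₀ m) ⊗ E ⊗ real (log ((m ^ n) /₀ N)) ≼ nat b
    conclude N b 1≤N N≤ bound =
      rat (N /₀ m) ⊗ E ⊗ logx         ≼⟨ ≼-reflexive (λ i → eq₁ (fromℕ N) (recip (fromℕ m)) (val E i) (val logx i)) ⟩
      rat r ⊗ E ⊗ (nat N ⊗ logx)      ≼⟨ ⊗-monoʳ (NonNeg-* (nonNeg λ _ → 0≤recip 1≤m) NonNeg-E)
                                          (≼-rearrange (⊕-mono (⊗-monoʳ (NonNeg-nat N) logx+ln≼) bound) λ i →
                                            eq₂ (fromℕ N) (val logx i) (val (ln N) i) (fromℕ n) (val (ln m) i) (val W i) (fromℕ b)) ⟩
      rat r ⊗ E ⊗ (W ⊗ nat b)         ≼⟨ ≼-reflexive (λ i → drop-unit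
                                          (trans (cong (r *_) (E*w i)) (trans (ℚ.*-comm r (fromℕ m)) (fromℕ-*-recip 1≤m)))
                                          (eq₃ r (val E i) (seq w i) (fromℕ b))) ⟩
      nat b                           ∎
      where
      r x : ℚ
      r = recip (fromℕ m)
      x = (m ^ n) /₀ N
      logx : Term
      logx = real (log x)
      1≤x : 1ℚ ℚ.≤ x
      1≤x = subst (ℚ._≤ x) (fromℕ-*-recip 1≤N) (*-monoˡ (recip (fromℕ N)) (0≤recip 1≤N) (fromℕ-mono N≤))
      logx+ln≼ : logx ⊕ ln N ≼ nat n ⊗ ln m
      logx+ln≼ = exp-cancel-≼ (NonNeg-+ (NonNeg-log 1≤x) (NonNeg-ln 1≤N)) (NonNeg-* (NonNeg-nat n) (NonNeg-ln 1≤m)) (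
        Exp (logx ⊕ ln N)           ≼⟨ exp-+≤ (NonNeg-log 1≤x) (NonNeg-ln 1≤N) ⟩
        Exp logx ⊗ Exp (ln N)       ≼⟨ ⊗-mono (NonNeg-exp (NonNeg-log 1≤x)) (NonNeg-nat N) (exp-log≼ 1≤x) (exp-log≼ (1≤fromℕ 1≤N)) ⟩
        rat x ⊗ nat N               ≼⟨ ≼-reflexive (λ _ → drop-unit (fromℕ-*-recip 1≤N) (eq₀ (fromℕ (m ^ n)) (fromℕ N) (recip (fromℕ N)))) ⟩
        nat (m ^ n)                 ≼⟨ ^≼exp-ln n 1≤m ⟩
        Exp (nat n ⊗ ln m)          ∎)
        where
        eq₀ : ∀ p N r → p * r * N ≡ p + (N * r - 1ℚ) * p
        eq₀ = solve 3 (λ p N r → p :* r :* N := p :+ (N :* r :- con 1ℚ) :* p) refl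
      eq₁ : ∀ N r E l → N * r * E * l ≡ r * E * (N * l)
      eq₁ = solve 4 (λ N r E l → N :* r :* E :* l := r :* E :* (N :* l)) refl
      eq₂ : ∀ N x l n L w b → N * x + (N * (n * L) + (w * b + N * l)) ≡ N * (x + l) + n * (N * L) + w * b
      eq₂ = solve 7 (λ N x l n L w b → N :* x :+ (N :* (n :* L) :+ (w :* b :+ N :* l)) :=
        N :* (x :+ l) :+ n :* (N :* L) :+ w :* b) refl
      eq₃ : ∀ r E w b → r * E * (w * b) ≡ b + (r * (E * w) - 1ℚ) * b
      eq₃ = solve 4 (λ r E w b → r :* E :* (w :* b) := b :+ (r :* (E :* w) :- con 1ℚ) :* b) refl

-- Passing from the hypotheses on `A` to inequalities between numbers

card-positive : ∀ G A → Nonempty G A → 1 ≤ card G A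
card-positive G A (v , Av) = subst (1 ≤_) (sym (length-filterᵇ A (Graph.vertices G)))
  (ℕ.≤-trans ([]-mono {true} λ _ → Av) (sumOver-∈ ([_] ∘ A) (Graph.complete G v)))

fromℕ-cancel-≤ : ∀ {a b} → fromℕ a ℚ.≤ fromℕ b → a ≤ b
fromℕ-cancel-≤ {a} {b} h = ℕ.≮⇒≥ λ b<a → ℚ.<-irrefl refl (ℚ.<-≤-trans b<1+b (ℚ.≤-trans (fromℕ-mono b<a) h))
  where
  b<1+b : fromℕ b ℚ.< fromℕ (suc b)
  b<1+b = subst₂ ℚ._<_ (ℚ.+-identityˡ (fromℕ b)) (sym (fromℕ-suc b)) (ℚ.+-monoˡ-< (fromℕ b) 0<1)

-- The hypothesis at ε = b / 2 already suffices.
≤-of-half : ∀ {a b} → 1 ≤ b → ℕ→ℝ a ≤ℝ fromℚ (b /₀ 2) → a ≤ b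
≤-of-half {a} {b} 1≤b h =
  let N , hN = h (0<* (ℚ.<-≤-trans 0<1 (1≤fromℕ 1≤b)) (0<recip (0<fromℕ-suc 1)))
  in fromℕ-cancel-≤ (subst (fromℕ a ℚ.≤_) (eq (fromℕ b)) (hN N ℕ.≤-refl))
  where
  eq : ∀ b → b * ½ + b * ½ ≡ b
  eq = solve 1 (λ b → b :* con ½ :+ b :* con ½ := b) refl

mainTheorem8 : (m n : ℕ) → 3 ≤ m → 1 ≤ n →
    (A : VertexSet (Path m □^ n)) → Nonempty (Path m □^ n) A →
    let ∣A∣ = card (Path m □^ n) A
        e[A,Aᶜ] = boundary (Path m □^ n) A
        [m/e]^n = (ℕ→ℝ m ÷ℝ (e , 0<e)) ^ℝ n
    in
    (ℕ→ℝ ∣A∣ ≤ℝ [m/e]^n →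
      ℕ→ℝ n *ℝ (fromℕ ∣A∣ ^ʳ fromℚ (1ℚ - 1 /₀ n)) ≤ℝ ℕ→ℝ e[A,Aᶜ])
    ×
    ([m/e]^n ≤ℝ ℕ→ℝ ∣A∣ → ℕ→ℝ ∣A∣ ≤ℝ fromℚ ((m ^ n) /₀ 2) →
      fromℚ (∣A∣ /₀ m) *ℝ e *ℝ log ((m ^ n) /₀ ∣A∣) ≤ℝ ℕ→ℝ e[A,Aᶜ])
mainTheorem8 (suc k) n _ 1≤n A ne =
    (λ h → ≼⇒≤ (small-sets k w 0≤w E*w n A 1≤n 1≤N ⟪ h ⟫))
  , (λ _ h → ≼⇒≤ (large-sets k w 0≤w E*w n A 1≤N (≤-of-half (ℕ.m^n>0 (suc k) n) h)))
  where
  1≤N : 1 ≤ card (Path (suc k) □^ n) A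
  1≤N = card-positive (Path (suc k) □^ n) A ne
  w : ℝ
  w = ℕ→ℝ (suc k) ÷ℝ (e , 0<e)
  0≤w : NonNeg (real w)
  0≤w = NonNeg-÷ℝ (ℕ→ℝ (suc k)) e 0<e (nonNeg λ _ → 0≤fromℕ (suc k)) 0<val-E
  E*w : ∀ i → val E i * seq w i ≡ fromℕ (suc k)
  E*w i = *-÷ℝ (ℕ→ℝ (suc k)) e 0<e i (0<val-E i)
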